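{- On the class of circle graphs, the treewidth and the Hadwiger number are linearly tied, and the Hajós number is quadratically tied to both the treewidth and the Hadwiger number. Both "linear" and "quadratic" are best possible: any function $f$ tying treewidth and Hadwiger number on circle graphs satisfies $f(x)=\Omega(x)$, and any function $f$ tying the Hajós number to the treewidth (or to the Hadwiger number) on circle graphs satisfies $f(x)=\Omega(x^2)$.
   Context: A chord of a circle is a closed line segment with distinct endpoints on the circle; two chords cross if they intersect at a point that is not an endpoint of either. A circle graph is a graph isomorphic to the graph whose vertices are the chords of a finite set of chords of a circle (no three crossing at a single point), two chords adjacent iff they cross. The Hadwiger number $h(G)$ is the largest $t$ such that $K_t$ is a minor of $G$; the Hajós number $h_{\mathrm{top}}(G)$ is the largest $t$ such that $K_t$ is a topological minor of $G$ (a subgraph of $G$ is isomorphic to a subdivision of $K_t$). For a graph class $\mathcal{G}$, two graph parameters $\alpha,\beta$ are tied on $\mathcal{G}$ if there is a function $f$ with $\alpha(G)\le f(\beta(G))$ and $\beta(G)\le f(\alpha(G))$ for all $G\in\mathcal{G}$; they are linearly (resp. quadratically) tied if $f$ can be taken to be linear (resp. quadratic). -}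

module Defs where

open import Level using (0ℓ)
open import Data.Nat using (ℕ; zero; suc; _+_; _*_; _≤_; _<_)
open import Data.Fin using (Fin)
import Data.Fin as F
open import Data.Fin.Subset using (Subset; _∈_; _∉_; ∣_∣)
open import Data.List using (List; []; _∷_; _++_; length)
open import Data.List.Relation.Unary.Linked using (Linked)
open import Data.List.Relation.Unary.Unique.Propositional using (Unique)
open import Data.List.Membership.Propositional using () renaming (_∈_ to _∈ₗ_; _∉_ to _∉ₗ_)
open import Data.Product using (Σ; ∃; ∃₂; _×_; _,_)
open import Data.Sum using (_⊎_)
open import Data.Unit using (⊤)
open import Relation.Nullary using (¬_)
open import Relation.Binary.PropositionalEquality using (_≡_; _≢_)

record Graph : Set₁ where
  field
    n     : ℕ
    E     : Fin n → Fin n → Set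
    E-sym : ∀ {u v} → E u v → E v u
    E-irr : ∀ {u} → ¬ E u u
open Graph public

record _≅_ (G H : Graph) : Set where
  field
    to      : Fin (n G) → Fin (n H)
    from    : Fin (n H) → Fin (n G)
    from-to : ∀ u → from (to u) ≡ u
    to-from : ∀ v → to (from v) ≡ v
    pres    : ∀ u v → E G u v → E H (to u) (to v)
    reflect : ∀ u v → E H (to u) (to v) → E G u v

data WalkIn (G : Graph) (P : Fin (n G) → Set) : Fin (n G) → Fin (n G) → Set where
  here : ∀ {u} → P u → WalkIn G P u u
  step : ∀ {u v w} → P u → E G u v → WalkIn G P v w → WalkIn G P u w

-- the subgraph induced by P is connected (vacuous for empty P)
ConnectedIn : (G : Graph) → (Fin (n G) → Set) → Set
ConnectedIn G P = ∀ u v → P u → P v → WalkIn G P u v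

AllVerts : (G : Graph) → Fin (n G) → Set
AllVerts G _ = ⊤

HasCycle : Graph → Set
HasCycle G = Σ (Fin (n G)) λ x → Σ (Fin (n G)) λ y → Σ (List (Fin (n G))) λ mid →
  (1 ≤ length mid) × Unique (x ∷ mid ++ y ∷ []) × Linked (E G) (x ∷ mid ++ y ∷ []) × E G y x

IsTree : Graph → Set
IsTree T = (1 ≤ n T) × ConnectedIn T (AllVerts T) × ¬ HasCycle T

record TreeDecomp (G : Graph) (k : ℕ) : Set₁ where
  field
    T        : Graph
    tree     : IsTree T
    bag      : Fin (n T) → Subset (n G)
    cover-v  : ∀ v → ∃ λ x → v ∈ bag x
    cover-e  : ∀ u v → E G u v → ∃ λ x → (u ∈ bag x) × (v ∈ bag x)
    coherent : ∀ v → ConnectedIn T (λ x → v ∈ bag x)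
    width    : ∀ x → ∣ bag x ∣ ≤ suc k

IsTreewidth : Graph → ℕ → Set₁
IsTreewidth G k = TreeDecomp G k × (∀ j → TreeDecomp G j → k ≤ j)

record KMinor (G : Graph) (t : ℕ) : Set where
  field
    branch    : Fin t → Subset (n G)
    nonempty  : ∀ i → ∃ λ v → v ∈ branch i
    connected : ∀ i → ConnectedIn G (λ v → v ∈ branch i)
    disjoint  : ∀ i j → i ≢ j → ∀ v → v ∈ branch i → v ∉ branch j
    adjacent  : ∀ i j → i ≢ j → ∃₂ λ u v → (u ∈ branch i) × (v ∈ branch j) × E G u v

IsHadwiger : Graph → ℕ → Set
IsHadwiger G t = KMinor G t × (∀ s → KMinor G s → s ≤ t)

record TopKMinor (G : Graph) (t : ℕ) : Set where
  field
    bv       : Fin t → Fin (n G)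
    bv-inj   : ∀ i j → bv i ≡ bv j → i ≡ j
    inner    : Fin t → Fin t → List (Fin (n G))
    path     : ∀ i j → i F.< j → Linked (E G) (bv i ∷ inner i j ++ bv j ∷ [])
    uniq     : ∀ i j → i F.< j → Unique (inner i j)
    avoid    : ∀ i j → i F.< j → ∀ k v → v ∈ₗ inner i j → v ≢ bv k
    disjoint : ∀ i j i' j' → i F.< j → i' F.< j' → (i ≢ i' ⊎ j ≢ j') →
               ∀ v → v ∈ₗ inner i j → v ∉ₗ inner i' j'

IsHajos : Graph → ℕ → Set
IsHajos G t = TopKMinor G t × (∀ s → TopKMinor G s → s ≤ t)

-- Circle graphs.  The endpoints of a finite set of chords are finitely
-- many points on the circle; numbering them along the circle from an
-- arbitrary base point, chord i has endpoints a i < b i (natural numbers).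
-- Chords are distinct.  Two chords cross iff their endpoints strictly
-- interleave (chords sharing an endpoint meet only there).

record ChordFamily (m : ℕ) : Set where
  field
    a        : Fin m → ℕ
    b        : Fin m → ℕ
    a<b      : ∀ i → a i < b i
    distinct : ∀ i j → a i ≡ a j → b i ≡ b j → i ≡ j

Crosses : ℕ → ℕ → ℕ → ℕ → Set
Crosses a b c d = (a < c × c < b × b < d) ⊎ (c < a × a < d × d < b)

crossing-sym : ∀ {a b c d} → Crosses a b c d → Crosses c d a b
crossing-sym (Data.Sum.inj₁ p) = Data.Sum.inj₂ p
crossing-sym (Data.Sum.inj₂ p) = Data.Sum.inj₁ p

open import Data.Nat.Properties using (<-irrefl; <-asym)
open import Relation.Binary.PropositionalEquality using (refl)

crossing-irr : ∀ {a b} → ¬ Crosses a b a b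
crossing-irr (Data.Sum.inj₁ (p , _)) = <-irrefl refl p
crossing-irr (Data.Sum.inj₂ (p , _)) = <-irrefl refl p

crossGraph : ∀ {m} → ChordFamily m → Graph
crossGraph {m} C = record
  { n = m
  ; E = λ i j → Crosses (a i) (b i) (a j) (b j)
  ; E-sym = crossing-sym
  ; E-irr = crossing-irr
  }
  where open ChordFamily C

IsCircleGraph : Graph → Set
IsCircleGraph G = Σ ℕ λ m → Σ (ChordFamily m) λ C → G ≅ crossGraph C

TiedBy : (Graph → ℕ → Set₁) → (Graph → ℕ → Set₁) → (ℕ → ℕ) → Set₁
TiedBy α β f = ∀ G → IsCircleGraph G → ∀ x y → α G x → β G y → (x ≤ f y) × (y ≤ f x)

LinearlyTied : (Graph → ℕ → Set₁) → (Graph → ℕ → Set₁) → Set₁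
LinearlyTied α β = ∃₂ λ c d → TiedBy α β (λ x → c * x + d)

QuadraticallyTied : (Graph → ℕ → Set₁) → (Graph → ℕ → Set₁) → Set₁
QuadraticallyTied α β = Σ ℕ λ p → Σ ℕ λ q → Σ ℕ λ r → TiedBy α β (λ x → p * (x * x) + q * x + r)

IsΩLinear : (ℕ → ℕ) → Set
IsΩLinear f = ∃₂ λ c x₀ → ∀ x → x₀ ≤ x → x ≤ c * f x

IsΩQuadratic : (ℕ → ℕ) → Set
IsΩQuadratic f = ∃₂ λ c x₀ → ∀ x → x₀ ≤ x → x * x ≤ c * f x

tw had haj : Graph → ℕ → Set₁
tw = IsTreewidth
had G t = Level.Lift (Level.suc 0ℓ) (IsHadwiger G t)
haj G t = Level.Lift (Level.suc 0ℓ) (IsHajos G t)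

{-# OPTIONS --safe #-}
-- Cut the circle between consecutive endpoints into gaps and let D(s,s') be the number of chords
-- separating two gaps; it extends to all choices of a side for each chord, in particular to the
-- median of three gaps, which chooses for each chord the side containing two of them.
--
-- If every median is within r of a gap, then the polygon of all gaps has a triangulation whose sides
-- have length at most 4r + 4, and the sets of chords meeting its triangles form a tree decomposition.
-- It is built recursively by finding an apex over each interval [p,q] with D(p,q) ≤ 4r + 4: the
-- medians of p, i, j for p ≤ i ≤ j ≤ q fill a triangle with boundary [p,q], and labelling each one by
-- a gap near it, Sperner's parity argument produces the apex.
--
-- If some median x is far from all gaps, the arcs cut off from x by the chords cover every gap many
-- times.  A minimal cover by inclusion-maximal arcs is connected in the crossing graph and covers no
-- gap more than four times, so it can be removed repeatedly; by maximality every chord of one cover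
-- crosses some chord of each later cover.  Contracting t covers gives K_t; joining one chord from
-- each of s covers through s² further covers gives a subdivision of K_s.
--
-- Conversely h ≤ tw + 1 by the Helly property of subtrees.  Complete graphs show that the linear bound
-- is optimal, and the disjoint union of K_x and K_{t,t} with t of order x² that the quadratic one is:
-- branch vertices on one side of K_{t,t} use a private vertex of the other side for every pair.
module Submission where

open import Defs
import Level
import Algebra.Properties.CommutativeSemigroup
open import Data.Bool using (Bool; true; false; _∧_; _∨_; _xor_; not)
import Data.Bool.Properties as Bool
open import Data.Nat using (ℕ; zero; suc; _+_; _*_; _∸_; _≤_; _<_; z≤n; s≤s; _≤?_; _<?_)
import Data.Nat.Properties as ℕ
open import Data.Nat.DivMod using (_/_; _%_; m≡m%n+[m/n]*n; m%n<n)
open import Data.Nat.Solver using (module +-*-Solver)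
open import Data.Fin using (Fin; zero; suc; toℕ; fromℕ<; _↑ˡ_; _↑ʳ_; splitAt)
import Data.Fin as F
import Data.Fin.Properties as F
open import Data.Fin.Subset using (Subset; _∈_; ∣_∣; _-_) renaming (⊤ to full)
import Data.Fin.Subset.Properties as S
open import Data.Vec using (tabulate)
import Data.Vec.Properties as Vec
open import Data.List using (List; []; _∷_; _++_)
open import Data.List.Relation.Unary.Linked using (Linked; []; [-]; _∷_)
open import Data.List.Relation.Unary.All using (All; []; _∷_)
import Data.List.Relation.Unary.All as All
open import Data.List.Relation.Unary.Any using (here; there)
open import Data.List.Relation.Unary.AllPairs using ([]; _∷_)
open import Data.List.Relation.Unary.Unique.Propositional using (Unique)
import Data.List.Membership.DecPropositional as DecMembership
open import Data.List.Membership.Propositional using () renaming (_∈_ to _∈ₗ_)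
open import Data.List.Membership.Propositional.Properties using (∈-++⁺ˡ; ∈-++⁺ʳ)
open import Data.Product using (∃; ∃₂; _×_; _,_; proj₁; proj₂)
open import Data.Sum using (_⊎_; inj₁; inj₂; [_,_]′)
open import Data.Unit using (tt)
open import Data.Empty using (⊥; ⊥-elim)
open import Function using (_∘_)
open import Relation.Nullary using (¬_; Dec; yes; no; does)
open import Relation.Nullary.Decidable using (_×-dec_; _⊎-dec_; dec-true; dec-false; ¬?; decidable-stable)
open import Relation.Unary using (Decidable)
open import Relation.Binary.Definitions using (tri<; tri≈; tri>)
open import Relation.Binary.PropositionalEquality using (_≡_; _≢_; refl; sym; trans; cong; cong₂; subst; module ≡-Reasoning)

-- Walks and the Helly property of subtrees

module _ {G : Graph} where

  walk-start : ∀ {P u v} → WalkIn G P u v → P u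
  walk-start (here p) = p
  walk-start (step p _ _) = p

  walk-map : ∀ {P Q u v} → (∀ x → P x → Q x) → WalkIn G P u v → WalkIn G Q u v
  walk-map f (here p) = here (f _ p)
  walk-map f (step p e w) = step (f _ p) e (walk-map f w)

  walk-++ : ∀ {P u v w} → WalkIn G P u v → WalkIn G P v w → WalkIn G P u w
  walk-++ (here _) w' = w'
  walk-++ (step p e w) w' = step p e (walk-++ w w')

  walk-rev : ∀ {P u v} → WalkIn G P u v → WalkIn G P v u
  walk-rev (here p) = here p
  walk-rev (step p e w) = walk-++ (walk-rev w) (step (walk-start w) (E-sym G e) (here p))

  data Path : Fin (n G) → Fin (n G) → List (Fin (n G)) → Set where
    [_] : ∀ u → Path u u (u ∷ [])
    _∷_ : ∀ {u v w l} → E G u v → Path v w l → Path u w (u ∷ l)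

  suffix-from : ∀ {P : Fin (n G) → Set} {u v w l} → u ∈ₗ l → Path v w l → Unique l → All P l →
                ∃ λ l' → Path u w l' × Unique l' × All P l'
  suffix-from (here refl) p@([ _ ]) q a = _ , p , q , a
  suffix-from (here refl) p@(_ ∷ _) q a = _ , p , q , a
  suffix-from (there i) (_ ∷ p) (_ ∷ q) (_ ∷ a) = suffix-from i p q a

  loop-erase : ∀ {P u v} → WalkIn G P u v → ∃ λ l → Path u v l × Unique l × All P l
  loop-erase (here p) = _ , [ _ ] , [] ∷ [] , p ∷ []
  loop-erase {u = u} (step p e w) with loop-erase w
  ... | l , q , un , al with DecMembership._∈?_ F._≟_ u l
  ...   | yes u∈l = suffix-from u∈l q un al
  ...   | no u∉l = u ∷ l , e ∷ q , All.tabulate (λ { i refl → u∉l i }) ∷ un , p ∷ al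

  path-linked : ∀ {t u v l} → E G t u → Path u v l → Linked (E G) (t ∷ l)
  path-linked e [ _ ] = e ∷ [-]
  path-linked e (e' ∷ p) = e ∷ path-linked e' p

  path-end : ∀ {u v l} → Path u v l → ∃ λ ms → l ≡ ms ++ v ∷ []
  path-end [ _ ] = [] , refl
  path-end (_ ∷ p) with path-end p
  ... | ms , refl = _ ∷ ms , refl

  -- Loop erasure leaves a simple path that still avoids `y`. Since `s` and `s'` differ, it has at
  -- least two vertices, so closing it up at `y` gives a genuine cycle.
  cycle-through : ∀ {y s s'} → E G y s → E G s' y → s ≢ s' → WalkIn G (_≢ y) s s' → HasCycle G
  cycle-through {y} {s} {s'} e e' s≢s' w with loop-erase w
  ... | _ , [ _ ] , _ , _ = ⊥-elim (s≢s' refl)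
  ... | _ , (f ∷ p) , un , al with path-end p
  ...   | ms , refl = y , s' , s ∷ ms , s≤s z≤n , All.map (λ ne eq → ne (sym eq)) al ∷ un
                    , path-linked e (f ∷ p) , e'

  first-hit : ∀ {P Q x q} → Decidable Q → WalkIn G P x q → Q q →
              Q x ⊎ ∃₂ λ y⁻ y → WalkIn G (¬_ ∘ Q) x y⁻ × E G y⁻ y × Q y
  first-hit Q? (here _) q = inj₁ q
  first-hit {x = x} Q? (step _ e w) q with Q? x
  ... | yes qx = inj₁ qx
  ... | no ¬qx with first-hit Q? w q
  ...   | inj₁ qv = inj₂ (x , _ , here ¬qx , e , qv)
  ...   | inj₂ (y⁻ , y , w' , e' , qy) = inj₂ (y⁻ , y , step ¬qx e w' , e' , qy)

  last-visit : ∀ {Q y z u} → z ≢ y → WalkIn G Q u z →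
               WalkIn G (λ x → Q x × x ≢ y) u z ⊎
               ∃ λ y⁺ → E G y y⁺ × WalkIn G (λ x → Q x × x ≢ y) y⁺ z
  last-visit z≢y (here q) = inj₁ (here (q , z≢y))
  last-visit {y = y} {u = u} z≢y (step q e w) with last-visit z≢y w
  ... | inj₂ r = inj₂ r
  ... | inj₁ w' with u F.≟ y
  ...   | yes refl = inj₂ (_ , e , w')
  ...   | no u≢y = inj₁ (step (q , u≢y) e w')

  -- The gate of Q seen from x: a connected P containing x and meeting Q at z but missing the
  -- gate y would close a cycle through y.
  gate : ∀ {Q x q} → ¬ HasCycle G → ConnectedIn G (AllVerts G) → Decidable Q → ConnectedIn G Q → Q q →
         ∃ λ y → Q y × (∀ {P} → Decidable P → ConnectedIn G P → P x → ∀ z → P z → Q z → P y)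
  gate {Q} {x} {q} acyclic conn Q? connQ qq with first-hit Q? (conn x q tt tt) qq
  ... | inj₁ qx = x , qx , λ _ _ px _ _ _ → px
  ... | inj₂ (y⁻ , y , w , e , qy) = y , qy , hits
    where
    hits : ∀ {P} → Decidable P → ConnectedIn G P → P x → ∀ z → P z → Q z → P y
    hits {P} P? connP px z pz qz with P? y
    ... | yes py = py
    ... | no ¬py with last-visit {y = y} (λ { refl → ¬py pz }) (connQ y z qy qz)
    ...   | inj₁ w' = ⊥-elim (proj₂ (walk-start w') refl)
    ...   | inj₂ (y⁺ , e⁺ , w') = ⊥-elim (acyclic (cycle-through e⁺ e
            (λ { refl → walk-start (walk-rev w) (proj₁ (walk-start w')) })
            (walk-++ (walk-map (λ _ → proj₂) w')
              (walk-++ (walk-map (λ { _ p refl → ¬py p }) (connP z x pz px))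
                       (walk-map (λ { _ ¬p refl → ¬p qy }) w)))))

  -- By induction all sets but the first share a point `x`. Each of them contains `x` and meets the
  -- first set, hence contains the gate of the first set seen from `x`, which is therefore common to
  -- all.
  helly : IsTree G → ∀ {t} (P : Fin t → Fin (n G) → Set) → (∀ i → Decidable (P i)) →
          (∀ i → ConnectedIn G (P i)) → (∀ i j → ∃ λ x → P i x × P j x) → ∃ λ x → ∀ i → P i x
  helly (n≥1 , _ , _) {zero} P P? conn meet = F.fromℕ< n≥1 , λ ()
  helly T@(_ , connT , acyclic) {suc t} P P? conn meet
    with helly T (P ∘ suc) (P? ∘ suc) (conn ∘ suc) (λ i j → meet (suc i) (suc j))
  ... | x , all with gate {x = x} acyclic connT (P? zero) (conn zero) (proj₁ (proj₂ (meet zero zero)))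
  ...   | y , py , hits = y , λ
          { zero → py
          ; (suc i) → let z , p0 , pi = meet zero (suc i) in
                      hits (P? (suc i)) (conn (suc i)) (all i) z pi p0 }

-- Clique minors and treewidth

injective-into⇒≤ : ∀ {t m} (f : Fin t → Fin m) (p : Subset m) → (∀ i j → f i ≡ f j → i ≡ j) →
                   (∀ i → f i ∈ p) → t ≤ ∣ p ∣
injective-into⇒≤ {zero} f p inj f∈p = z≤n
injective-into⇒≤ {suc t} f p inj f∈p = ℕ.≤-trans (s≤s ih) (S.x∈p⇒∣p-x∣<∣p∣ (f∈p zero))
  where
  ih : t ≤ ∣ p - f zero ∣
  ih = injective-into⇒≤ (f ∘ suc) (p - f zero) (λ i j e → F.suc-injective (inj (suc i) (suc j) e))
         (λ i → S.x∈p∧x≢y⇒x∈p-y (f∈p (suc i)) (λ e → F.0≢1+n (sym (inj (suc i) zero e))))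

-- The tree nodes whose bags meet a given branch set form a connected set, because consecutive
-- vertices of a walk share a bag. Two such sets intersect at a bag covering an edge between the
-- branch sets. The Helly point is a bag that meets all `t` disjoint branch sets.
minor≤width : ∀ {G t k} → KMinor G t → TreeDecomp G k → t ≤ suc k
minor≤width {G} {t} {k} K D = ℕ.≤-trans
    (injective-into⇒≤ (proj₁ ∘ common) (bag x) inj (λ i → proj₂ (proj₂ (common i)))) (width x)
  where
  open KMinor K
  open TreeDecomp D
  Hit : Fin t → Fin (n T) → Set
  Hit i x = ∃ λ v → v ∈ branch i × v ∈ bag x
  hit-walk : ∀ i {u v} → WalkIn G (_∈ branch i) u v → ∀ x y → u ∈ bag x → v ∈ bag y →
             WalkIn T (Hit i) x y
  hit-walk i (here p) x y u∈x v∈y = walk-map (λ _ q → _ , p , q) (coherent _ x y u∈x v∈y)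
  hit-walk i (step p e w) x y u∈x v∈y =
    let z , u∈z , v∈z = cover-e _ _ e
    in walk-++ (walk-map (λ _ q → _ , p , q) (coherent _ x z u∈x u∈z)) (hit-walk i w z y v∈z v∈y)
  meet : ∀ i j → ∃ λ x → Hit i x × Hit j x
  meet i j with i F.≟ j
  ... | yes refl = let v , v∈i = nonempty i ; x , v∈x = cover-v v
                   in x , (v , v∈i , v∈x) , (v , v∈i , v∈x)
  ... | no i≢j = let u , v , u∈i , v∈j , e = adjacent i j i≢j ; x , u∈x , v∈x = cover-e u v e
                 in x , (u , u∈i , u∈x) , (v , v∈j , v∈x)
  point : ∃ λ x → ∀ i → Hit i x
  point = helly tree Hit (λ i x → F.any? (λ v → (v S.∈? branch i) ×-dec (v S.∈? bag x)))
            (λ { i x y (u , u∈i , u∈x) (v , v∈i , v∈y) → hit-walk i (connected i u v u∈i v∈i) x y u∈x v∈y })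
            meet
  x = proj₁ point
  common = proj₂ point
  inj : ∀ i j → proj₁ (common i) ≡ proj₁ (common j) → i ≡ j
  inj i j e with i F.≟ j
  ... | yes i≡j = i≡j
  ... | no i≢j = ⊥-elim (disjoint i j i≢j _ (proj₁ (proj₂ (common i)))
                   (subst (_∈ branch j) (sym e) (proj₁ (proj₂ (common j)))))

-- Topological minors and rooted trees

∈-tabulate⁺ : ∀ {m} (f : Fin m → Bool) {i} → f i ≡ true → i ∈ tabulate f
∈-tabulate⁺ f {i} e = Vec.lookup⇒[]= i _ (trans (Vec.lookup∘tabulate f i) e)

∈-tabulate⁻ : ∀ {m} (f : Fin m → Bool) {i} → i ∈ tabulate f → f i ≡ true
∈-tabulate⁻ f {i} i∈ = trans (sym (Vec.lookup∘tabulate f i)) (Vec.[]=⇒lookup i∈)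

does-true⁻ : ∀ {P : Set} (P? : Dec P) → does P? ≡ true → P
does-true⁻ (yes p) _ = p

module _ {G : Graph} where

  prefix-walk : ∀ {P u v w} l → Linked (E G) (u ∷ l ++ v ∷ []) → P u → (∀ {x} → x ∈ₗ l → P x) →
                w ∈ₗ l → WalkIn G P u w
  prefix-walk (x ∷ l) (e ∷ L) pu pl (here refl) = step pu e (here (pl (here refl)))
  prefix-walk (x ∷ l) (e ∷ L) pu pl (there i) =
    step pu e (prefix-walk l L (pl (here refl)) (pl ∘ there) i)

  last-edge : ∀ {u v} l → Linked (E G) (u ∷ l ++ v ∷ []) → ∃ λ w → (w ≡ u ⊎ w ∈ₗ l) × E G w v
  last-edge [] (e ∷ _) = _ , inj₁ refl , e
  last-edge (x ∷ l) (_ ∷ L) with last-edge l L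
  ... | w , inj₁ refl , e = w , inj₂ (here refl) , e
  ... | w , inj₂ i , e = w , inj₂ (there i) , e

-- The interior of the path between two branch vertices goes to the smaller index; the last edge of
-- the path then joins the two branch sets.
top-minor⇒minor : ∀ {G t} → TopKMinor G t → KMinor G t
top-minor⇒minor {G} {t} K = record
  { branch = branch
  ; nonempty = λ i → bv i , root i
  ; connected = λ i u v u∈ v∈ → walk-++ (walk-rev (from-root i u∈)) (from-root i v∈)
  ; disjoint = λ i j i≢j v v∈i v∈j → apart i≢j (out i v∈i) (out j v∈j)
  ; adjacent = adjacent
  }
  where
  open TopKMinor K
  Own : Fin t → Fin (n G) → Set
  Own i v = v ≡ bv i ⊎ ∃ λ j → i F.< j × v ∈ₗ inner i j
  own? : ∀ i → Decidable (Own i)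
  own? i v = (v F.≟ bv i) ⊎-dec F.any? (λ j → (i F.<? j) ×-dec DecMembership._∈?_ F._≟_ v (inner i j))
  branch : Fin t → Subset (n G)
  branch i = tabulate (does ∘ own? i)
  into : ∀ i {v} → Own i v → v ∈ branch i
  into i o = ∈-tabulate⁺ _ (dec-true (own? i _) o)
  out : ∀ i {v} → v ∈ branch i → Own i v
  out i v∈ = does-true⁻ (own? i _) (∈-tabulate⁻ _ v∈)
  root : ∀ i → bv i ∈ branch i
  root i = into i (inj₁ refl)
  from-root : ∀ i {v} → v ∈ branch i → WalkIn G (_∈ branch i) (bv i) v
  from-root i v∈ with out i v∈
  ... | inj₁ refl = here v∈
  ... | inj₂ (j , i<j , v∈l) =
    prefix-walk (inner i j) (path i j i<j) (root i) (λ x∈ → into i (inj₂ (j , i<j , x∈))) v∈l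
  apart : ∀ {i j v} → i ≢ j → Own i v → Own j v → ⊥
  apart {i} {j} i≢j (inj₁ e) (inj₁ e') = i≢j (bv-inj i j (trans (sym e) e'))
  apart {i} {j} i≢j (inj₁ e) (inj₂ (k , j<k , v∈)) = avoid j k j<k i _ v∈ e
  apart {i} {j} i≢j (inj₂ (k , i<k , v∈)) (inj₁ e) = avoid i k i<k j _ v∈ e
  apart {i} {j} i≢j (inj₂ (k , i<k , v∈)) (inj₂ (k' , j<k' , v∈')) =
    disjoint i k j k' i<k j<k' (inj₁ i≢j) _ v∈ v∈'
  edge : ∀ {i j} → i F.< j → ∃ λ w → w ∈ branch i × E G w (bv j)
  edge {i} {j} i<j with last-edge {G} (inner i j) (path i j i<j)
  ... | w , inj₁ e , ew = w , into i (inj₁ e) , ew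
  ... | w , inj₂ w∈ , ew = w , into i (inj₂ (j , i<j , w∈)) , ew
  adjacent : ∀ i j → i ≢ j → ∃₂ λ u v → (u ∈ branch i) × (v ∈ branch j) × E G u v
  adjacent i j i≢j with F.<-cmp i j
  ... | tri< i<j _ _ = let w , w∈ , e = edge i<j in w , bv j , w∈ , root j , e
  ... | tri≈ _ e _ = ⊥-elim (i≢j e)
  ... | tri> _ _ j<i = let w , w∈ , e = edge j<i in bv i , w , root i , w∈ , E-sym G e

module _ (G : Graph) (single-smaller-nbr : ∀ {u v w} → E G u v → E G u w → v F.< u → w F.< u → v ≡ w) where

  private
    compare : ∀ {u v} → E G u v → u F.< v ⊎ v F.< u
    compare {u} {v} e with F.<-cmp u v
    ... | tri< l _ _ = inj₁ l
    ... | tri≈ _ refl _ = ⊥-elim (E-irr G e)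
    ... | tri> _ _ l = inj₂ l

  -- Along a simple path, an ascent can only be followed by ascents.
  path-shape : ∀ u v ms y → Unique (u ∷ v ∷ ms ++ y ∷ []) → Linked (E G) (u ∷ v ∷ ms ++ y ∷ []) →
    ∃ λ z → z ∈ₗ (v ∷ ms) × E G z y × (u F.< v → u F.< y × z F.< y) × (z F.< y ⊎ y F.< u)
  path-shape u v [] y ((_ ∷ u≢y ∷ []) ∷ _) (e ∷ e' ∷ [-]) = v , here refl , e' , up , down
    where
    up : u F.< v → u F.< y × v F.< y
    up u<v with compare e'
    ... | inj₁ v<y = ℕ.<-trans u<v v<y , v<y
    ... | inj₂ y<v = ⊥-elim (u≢y (single-smaller-nbr (E-sym G e) e' u<v y<v))
    down : v F.< y ⊎ y F.< u
    down with compare e'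
    ... | inj₁ v<y = inj₁ v<y
    ... | inj₂ y<v with compare e
    ...   | inj₁ u<v = inj₁ (proj₂ (up u<v))
    ...   | inj₂ v<u = inj₂ (ℕ.<-trans y<v v<u)
  path-shape u v (w ∷ ms) y ((u≢v ∷ u≢w ∷ us) ∷ un) (e ∷ L@(e' ∷ _)) with path-shape v w ms y un L
  ... | z , z∈ , ez , up' , down' = z , there z∈ , ez , up , down down'
    where
    up : u F.< v → u F.< y × z F.< y
    up u<v with compare e'
    ... | inj₁ v<w = ℕ.<-trans u<v (proj₁ (up' v<w)) , proj₂ (up' v<w)
    ... | inj₂ w<v = ⊥-elim (u≢w (single-smaller-nbr (E-sym G e) e' u<v w<v))
    down : z F.< y ⊎ y F.< v → z F.< y ⊎ y F.< u
    down (inj₁ l) = inj₁ l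
    down (inj₂ y<v) with compare e
    ... | inj₁ u<v = inj₁ (proj₂ (up u<v))
    ... | inj₂ v<u = inj₂ (ℕ.<-trans y<v v<u)

  -- The larger end of the closing edge has two smaller neighbours on the cycle: the other end and,
  -- by `path-shape`, its neighbour along the path. They are distinct because the path is simple.
  acyclic : ¬ HasCycle G
  acyclic (x , y , v ∷ ms , _ , un@(x≢ ∷ v≢ ∷ _) , L@(e ∷ _) , eyx) with path-shape x v ms y un L
  ... | z , z∈ , ez , up , down with compare eyx
  ...   | inj₂ x<y with down
  ...     | inj₁ z<y = All.lookup x≢ (∈-++⁺ˡ z∈) (single-smaller-nbr eyx (E-sym G ez) x<y z<y)
  ...     | inj₂ y<x = ℕ.<-asym x<y y<x
  acyclic (x , y , v ∷ ms , _ , un@(x≢ ∷ v≢ ∷ _) , L@(e ∷ _) , eyx) | z , z∈ , ez , up , down | inj₁ y<x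
    with compare e
  ... | inj₁ x<v = ℕ.<-asym y<x (proj₁ (up x<v))
  ... | inj₂ v<x = All.lookup v≢ (∈-++⁺ʳ ms (here refl)) (single-smaller-nbr e (E-sym G eyx) v<x y<x)

-- Vertex `zero` is the root and `par i` is the parent of `suc i`. Since parents precede their
-- children, every vertex has at most one smaller neighbour, and following parents reaches the root.
record Rooted : Set where
  field
    size : ℕ
    par  : Fin size → Fin (suc size)
    par≤ : ∀ i → toℕ (par i) ≤ toℕ i

module _ (R : Rooted) where
  open Rooted R

  Child : Fin (suc size) → Fin (suc size) → Set
  Child u v = ∃ λ i → u ≡ suc i × v ≡ par i

  child⇒> : ∀ {u v} → Child u v → v F.< u
  child⇒> (i , refl , refl) = s≤s (par≤ i)

  rootedGraph : Graph
  rootedGraph = record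
    { n = suc size
    ; E = λ u v → Child u v ⊎ Child v u
    ; E-sym = λ { (inj₁ c) → inj₂ c ; (inj₂ c) → inj₁ c }
    ; E-irr = λ { (inj₁ c) → ℕ.<-irrefl refl (child⇒> c) ; (inj₂ c) → ℕ.<-irrefl refl (child⇒> c) }
    }

  private
    to-root : ∀ k u → toℕ u ≤ k → WalkIn rootedGraph (AllVerts rootedGraph) u zero
    to-root k zero _ = here tt
    to-root (suc k) (suc i) (s≤s i≤k) =
      step tt (inj₁ (i , refl , refl)) (to-root k (par i) (ℕ.≤-trans (par≤ i) i≤k))

    smaller : ∀ {u v w} → E rootedGraph u v → E rootedGraph u w → v F.< u → w F.< u → v ≡ w
    smaller (inj₁ (i , refl , refl)) (inj₁ (.i , refl , refl)) _ _ = refl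
    smaller (inj₂ c) _ v<u _ = ⊥-elim (ℕ.<-asym v<u (child⇒> c))
    smaller (inj₁ _) (inj₂ c) _ w<u = ⊥-elim (ℕ.<-asym w<u (child⇒> c))

  rooted-tree : IsTree rootedGraph
  rooted-tree = s≤s z≤n
              , (λ u v _ _ → walk-++ (to-root _ u ℕ.≤-refl) (walk-rev (to-root _ v ℕ.≤-refl)))
              , acyclic rootedGraph smaller

single : Rooted
single = record { size = 0 ; par = λ () ; par≤ = λ () }

module _ (L R : Rooted) where
  private
    module L = Rooted L
    module R = Rooted R

  left : Fin (suc L.size) → Fin (suc (suc L.size + suc R.size))
  left u = suc (u ↑ˡ suc R.size)

  right : Fin (suc R.size) → Fin (suc (suc L.size + suc R.size))
  right u = suc (suc L.size ↑ʳ u)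

  private
    joined-par : Fin (suc L.size) ⊎ Fin (suc R.size) → Fin (suc (suc L.size + suc R.size))
    joined-par (inj₁ zero) = zero
    joined-par (inj₁ (suc i)) = left (L.par i)
    joined-par (inj₂ zero) = zero
    joined-par (inj₂ (suc i)) = right (R.par i)

    joined-par≤ : ∀ s → toℕ (joined-par s) ≤ toℕ (F.join (suc L.size) (suc R.size) s)
    joined-par≤ (inj₁ zero) = z≤n
    joined-par≤ (inj₁ (suc i)) rewrite F.toℕ-↑ˡ (L.par i) (suc R.size) | F.toℕ-↑ˡ i (suc R.size) =
      s≤s (L.par≤ i)
    joined-par≤ (inj₂ zero) = z≤n
    joined-par≤ (inj₂ (suc i)) rewrite F.toℕ-↑ʳ L.size (R.par i) | F.toℕ-↑ʳ L.size (suc i) =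
      s≤s (subst (_≤ L.size + suc (toℕ i)) (ℕ.+-suc L.size _) (ℕ.+-monoʳ-≤ L.size (s≤s (R.par≤ i))))

  joined : Rooted
  joined = record
    { size = suc L.size + suc R.size
    ; par = joined-par ∘ splitAt (suc L.size)
    ; par≤ = λ i → subst (λ k → toℕ (joined-par (splitAt (suc L.size) i)) ≤ toℕ k)
                     (F.join-splitAt (suc L.size) (suc R.size) i)
                     (joined-par≤ (splitAt (suc L.size) i))
    }

  data Position : Fin (suc (suc L.size + suc R.size)) → Set where
    root   : Position zero
    leftₚ  : ∀ u → Position (left u)
    rightₚ : ∀ u → Position (right u)

  position : ∀ u → Position u
  position zero = root
  position (suc i) with splitAt (suc L.size) i in eq
  ... | inj₁ u = subst (Position ∘ suc) (F.splitAt⁻¹-↑ˡ eq) (leftₚ u)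
  ... | inj₂ u = subst (Position ∘ suc) (F.splitAt⁻¹-↑ʳ eq) (rightₚ u)

  private
    child-left : ∀ {u v} → Child L u v → Child joined (left u) (left v)
    child-left (i , refl , refl) = suc i ↑ˡ suc R.size , refl ,
      sym (cong joined-par (F.splitAt-↑ˡ (suc L.size) (suc i) (suc R.size)))

    child-right : ∀ {u v} → Child R u v → Child joined (right u) (right v)
    child-right (i , refl , refl) = suc L.size ↑ʳ suc i , refl ,
      sym (cong joined-par (F.splitAt-↑ʳ (suc L.size) (suc R.size) (suc i)))

  left-edge : ∀ {u v} → E (rootedGraph L) u v → E (rootedGraph joined) (left u) (left v)
  left-edge (inj₁ c) = inj₁ (child-left c)
  left-edge (inj₂ c) = inj₂ (child-left c)

  right-edge : ∀ {u v} → E (rootedGraph R) u v → E (rootedGraph joined) (right u) (right v)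
  right-edge (inj₁ c) = inj₁ (child-right c)
  right-edge (inj₂ c) = inj₂ (child-right c)

  root-left : E (rootedGraph joined) zero (left zero)
  root-left = inj₂ (zero , refl , refl)

  root-right : E (rootedGraph joined) zero (right zero)
  root-right = inj₂ (suc L.size ↑ʳ zero , refl ,
    sym (cong joined-par (F.splitAt-↑ʳ (suc L.size) (suc R.size) zero)))

walk-image : ∀ {G H : Graph} {P Q} (f : Fin (n G) → Fin (n H)) →
             (∀ {u v} → E G u v → E H (f u) (f v)) → (∀ {u} → P u → Q (f u)) →
             ∀ {u v} → WalkIn G P u v → WalkIn H Q (f u) (f v)
walk-image f pe pp (here p) = here (pp p)
walk-image f pe pp (step p e w) = step (pp p) (pe e) (walk-image f pe pp w)

-- Counting, and the tree decomposition of a triangulated diagram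

bit : Bool → ℕ
bit true = 1
bit false = 0

count : ∀ {m} → (Fin m → Bool) → ℕ
count {zero} f = 0
count {suc m} f = bit (f zero) + count (f ∘ suc)

∣tabulate∣ : ∀ {m} (f : Fin m → Bool) → ∣ tabulate f ∣ ≡ count f
∣tabulate∣ {zero} f = refl
∣tabulate∣ {suc m} f with f zero
... | true = cong suc (∣tabulate∣ (f ∘ suc))
... | false = ∣tabulate∣ (f ∘ suc)

count-mono : ∀ {m} (f g : Fin m → Bool) → (∀ i → bit (f i) ≤ bit (g i)) → count f ≤ count g
count-mono {zero} f g h = z≤n
count-mono {suc m} f g h = ℕ.+-mono-≤ (h zero) (count-mono (f ∘ suc) (g ∘ suc) (h ∘ suc))

open Algebra.Properties.CommutativeSemigroup ℕ.+-commutativeSemigroup using (interchange)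

count-subadditive : ∀ {m} (f g h : Fin m → Bool) → (∀ i → bit (f i) ≤ bit (g i) + bit (h i)) →
                    count f ≤ count g + count h
count-subadditive {zero} f g h q = z≤n
count-subadditive {suc m} f g h q = ℕ.≤-trans
  (ℕ.+-mono-≤ (q zero) (count-subadditive (f ∘ suc) (g ∘ suc) (h ∘ suc) (q ∘ suc)))
  (ℕ.≤-reflexive (interchange (bit (g zero)) (bit (h zero)) (count (g ∘ suc)) (count (h ∘ suc))))

count-superadditive : ∀ {m} (f g h : Fin m → Bool) → (∀ i → bit (f i) + bit (g i) ≤ bit (h i)) →
                      count f + count g ≤ count h
count-superadditive {zero} f g h q = z≤n
count-superadditive {suc m} f g h q = ℕ.≤-trans
  (ℕ.≤-reflexive (interchange (bit (f zero)) (count (f ∘ suc)) (bit (g zero)) (count (g ∘ suc))))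
  (ℕ.+-mono-≤ (q zero) (count-superadditive (f ∘ suc) (g ∘ suc) (h ∘ suc) (q ∘ suc)))

_∖_ : ∀ {m} → (Fin m → Bool) → Fin m → Fin m → Bool
(f ∖ i) j = f j ∧ not (does (j F.≟ i))

∖-true⁻ : ∀ {m} {f : Fin m → Bool} {i j} → (f ∖ i) j ≡ true → f j ≡ true × j ≢ i
∖-true⁻ {f = f} {i} {j} e with f j | j F.≟ i
... | true | no ne = refl , ne

∖-true⁺ : ∀ {m} {f : Fin m → Bool} {i j} → f j ≡ true → j ≢ i → (f ∖ i) j ≡ true
∖-true⁺ {f = f} {i} {j} e ne with f j | j F.≟ i
... | true | no _ = refl
... | true | yes eq = ⊥-elim (ne eq)

count-extract : ∀ {m} (f : Fin m → Bool) {k} → suc k ≤ count f → ∃ λ i → f i ≡ true × k ≤ count (f ∖ i)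
count-extract {suc m} f {k} q with f zero in eq
... | true = zero , eq , ℕ.≤-trans (ℕ.≤-pred q) (ℕ.≤-trans
      (count-mono (f ∘ suc) ((f ∖ zero) ∘ suc)
        (λ i → ℕ.≤-reflexive (cong bit (sym (Bool.∧-identityʳ (f (suc i)))))))
      (ℕ.m≤n+m _ _))
... | false with count-extract (f ∘ suc) q
...   | i , fi , k≤ = suc i , fi , ℕ.≤-trans k≤ (ℕ.m≤n+m _ _)

count-remove : ∀ {m} (f : Fin m → Bool) i → f i ≡ true → suc (count (f ∖ i)) ≤ count f
count-remove {suc m} f zero e rewrite e = s≤s (count-mono ((f ∖ zero) ∘ suc) (f ∘ suc)
  (λ i → ℕ.≤-reflexive (cong bit (Bool.∧-identityʳ (f (suc i))))))
count-remove {suc m} f (suc i) e with f zero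
... | true = s≤s (count-remove (f ∘ suc) i e)
... | false = count-remove (f ∘ suc) i e

count-unique : ∀ {m} (f : Fin m → Bool) → (∀ i j → f i ≡ true → f j ≡ true → i ≡ j) → count f ≤ 1
count-unique f uniq with count f ≤? 1
... | yes q = q
... | no ¬q with count-extract f (ℕ.≰⇒> ¬q)
...   | i , fi , q with count-extract (f ∖ i) q
...     | j , fj , _ = ⊥-elim (proj₂ (∖-true⁻ {f = f} {i} fj) (uniq j i (proj₁ (∖-true⁻ {f = f} {i} fj)) fi))

-- Unlike in `ChordFamily`, all endpoints are different, so that passing one position changes the
-- side of at most one chord. The chords are indexed by the vertices of `G` themselves.
record Diagram (G : Graph) : Set where
  field
    a b   : Fin (n G) → ℕ
    a<b   : ∀ c → a c < b c
    a-inj : ∀ {c d} → a c ≡ a d → c ≡ d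
    b-inj : ∀ {c d} → b c ≡ b d → c ≡ d
    a≢b   : ∀ {c d} → a c ≢ b d
    E⇒    : ∀ {c d} → E G c d → Crosses (a c) (b c) (a d) (b d)
    ⇒E    : ∀ {c d} → Crosses (a c) (b c) (a d) (b d) → E G c d

xor-false⇒≡ : ∀ {u v} → u xor v ≡ false → u ≡ v
xor-false⇒≡ {false} {false} _ = refl
xor-false⇒≡ {true} {true} _ = refl

false-xor-true : ∀ {u v} → u ≡ false → v ≡ true → u xor v ≡ true
false-xor-true refl refl = refl

true-xor-false : ∀ {u v} → u ≡ true → v ≡ false → u xor v ≡ true
true-xor-false refl refl = refl

∨-false⁻ˡ : ∀ {u v} → u ∨ v ≡ false → u ≡ false
∨-false⁻ˡ {false} _ = refl

xor-true⇒not : ∀ {u v} → u xor v ≡ true → v ≡ not u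
xor-true⇒not {false} {true} _ = refl
xor-true⇒not {true} {false} _ = refl

xor-triangle : ∀ u v w → bit (u xor w) ≤ bit (u xor v) + bit (v xor w)
xor-triangle false false w = ℕ.≤-refl
xor-triangle true true w = ℕ.≤-refl
xor-triangle false true false = z≤n
xor-triangle false true true = s≤s z≤n
xor-triangle true false false = s≤s z≤n
xor-triangle true false true = z≤n

hamming : ∀ {m} → (Fin m → Bool) → (Fin m → Bool) → ℕ
hamming x y = count (λ c → x c xor y c)

hamming-sym : ∀ {m} (x y : Fin m → Bool) → hamming x y ≤ hamming y x
hamming-sym x y = count-mono _ _ (λ c → ℕ.≤-reflexive (cong bit (Bool.xor-comm (x c) (y c))))

hamming-triangle : ∀ {m} (x y z : Fin m → Bool) → hamming x z ≤ hamming x y + hamming y z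
hamming-triangle x y z = count-subadditive _ _ _ (λ c → xor-triangle (x c) (y c) (z c))

module Gaps {G : Graph} (Δ : Diagram G) where
  open Diagram Δ public

  -- The gap s is the open arc just before the position s.
  ins : Fin (n G) → ℕ → Bool
  ins c s = does ((a c <? s) ×-dec (s ≤? b c))

  ins-true : ∀ {c s} → a c < s → s ≤ b c → ins c s ≡ true
  ins-true {c} {s} p q = dec-true ((a c <? s) ×-dec (s ≤? b c)) (p , q)

  ins-true⁻ : ∀ {c s} → ins c s ≡ true → a c < s × s ≤ b c
  ins-true⁻ {c} {s} = does-true⁻ ((a c <? s) ×-dec (s ≤? b c))

  ins-before : ∀ {c s} → s ≤ a c → ins c s ≡ false
  ins-before {c} {s} p = dec-false ((a c <? s) ×-dec (s ≤? b c)) (λ q → ℕ.<⇒≱ (proj₁ q) p)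

  ins-after : ∀ {c s} → b c < s → ins c s ≡ false
  ins-after {c} {s} p = dec-false ((a c <? s) ×-dec (s ≤? b c)) (λ q → ℕ.<⇒≱ p (proj₂ q))

  ins-convex : ∀ {c u v w} → u ≤ v → v ≤ w → ins c u ≡ true → ins c w ≡ true → ins c v ≡ true
  ins-convex u≤v v≤w p q = ins-true (ℕ.<-≤-trans (proj₁ (ins-true⁻ p)) u≤v)
                                    (ℕ.≤-trans v≤w (proj₂ (ins-true⁻ q)))

  -- The gaps inside a chord form an interval, so the side of the chord changes at most twice along
  -- the line, whereas this pattern changes three times.
  no-alternation : ∀ {c β u v w z} → u ≤ v → v ≤ w → w ≤ z → ins c u ≡ β → ins c v ≡ not β →
                   ins c w ≡ β → ins c z ≡ not β → ⊥
  no-alternation {β = true} uv vw wz p q r s with trans (sym (ins-convex uv vw p r)) q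
  ... | ()
  no-alternation {β = false} uv vw wz p q r s with trans (sym (ins-convex vw wz q s)) r
  ... | ()

  change : ∀ {c s} → ins c s xor ins c (suc s) ≡ true → s ≡ a c ⊎ s ≡ b c
  change {c} {s} e with ℕ.<-cmp s (a c) | ℕ.<-cmp s (b c)
  ... | tri≈ _ p _ | _ = inj₁ p
  ... | _ | tri≈ _ p _ = inj₂ p
  ... | tri< p _ _ | _ rewrite ins-before {c} {s} (ℕ.<⇒≤ p) | ins-before {c} {suc s} p with () ← e
  ... | tri> _ _ p | tri< q _ _ 
    rewrite ins-true {c} {s} p (ℕ.<⇒≤ q) | ins-true {c} {suc s} (ℕ.m<n⇒m<1+n p) q with () ← e
  ... | tri> _ _ _ | tri> _ _ q rewrite ins-after {c} {s} q | ins-after {c} {suc s} (ℕ.m<n⇒m<1+n q) with () ← e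

  change-unique : ∀ {c d s} → ins c s xor ins c (suc s) ≡ true → ins d s xor ins d (suc s) ≡ true → c ≡ d
  change-unique {c} {d} {s} p q with change {c} {s} p | change {d} {s} q
  ... | inj₁ e | inj₁ f = a-inj (trans (sym e) f)
  ... | inj₁ e | inj₂ f = ⊥-elim (a≢b (trans (sym e) f))
  ... | inj₂ e | inj₁ f = ⊥-elim (a≢b (trans (sym f) e))
  ... | inj₂ e | inj₂ f = b-inj (trans (sym e) f)

  gap : ℕ → Fin (n G) → Bool
  gap s c = ins c s

  D : ℕ → ℕ → ℕ
  D s s' = hamming (gap s) (gap s')

  D-step : ∀ s → D s (suc s) ≤ 1
  D-step s = count-unique _ (λ c d → change-unique {c} {d} {s})

  -- A triangulation of the polygon on the gaps from `x` to `z`, stored as the binary tree of its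
  -- triangles: `node` is the triangle over the side from `x` to `z` with apex `y`, and `unit` is a
  -- boundary side. The bound `k` is imposed on the two new sides of each triangle.
  data Tri (k : ℕ) : ℕ → ℕ → Set where
    unit : ∀ s → Tri k s (suc s)
    node : ∀ {x y z} → x < y → y < z → D x y ≤ k → D y z ≤ k → Tri k x y → Tri k y z → Tri k x z

  module _ {k : ℕ} where

    tree : ∀ {x z} → Tri k x z → Rooted
    tree (unit s) = single
    tree (node _ _ _ _ l r) = joined (tree l) (tree r)

    T : ∀ {x z} → Tri k x z → Graph
    T τ = rootedGraph (tree τ)

    -- A chord separating `x` from `z` also separates one of the other two pairs, so these two sides
    -- account for every chord meeting the triangle, and there are at most `k + k` of them.
    corner : ℕ → ℕ → ℕ → Fin (n G) → Bool
    corner x y z c = (ins c x xor ins c y) ∨ (ins c y xor ins c z)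

    members : ∀ {x z} (τ : Tri k x z) → Fin (n (T τ)) → Fin (n G) → Bool
    members (unit s) _ c = ins c s xor ins c (suc s)
    members {x} {z} (node {y = y} _ _ _ _ l r) zero = corner x y z
    members (node _ _ _ _ l r) (suc i) = [ members l , members r ]′ (splitAt _ i)

    _∋_at_ : ∀ {x z} (τ : Tri k x z) → Fin (n G) → Fin (n (T τ)) → Set
    τ ∋ c at u = members τ u c ≡ true

    members-left : ∀ {x y z} (p : x < y) (q : y < z) d d' (l : Tri k x y) (r : Tri k y z) u →
                   members (node p q d d' l r) (left (tree l) (tree r) u) ≡ members l u
    members-left p q d d' l r u = cong [ members l , members r ]′ (F.splitAt-↑ˡ _ u _)

    members-right : ∀ {x y z} (p : x < y) (q : y < z) d d' (l : Tri k x y) (r : Tri k y z) u →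
                    members (node p q d d' l r) (right (tree l) (tree r) u) ≡ members r u
    members-right p q d d' l r u = cong [ members l , members r ]′ (F.splitAt-↑ʳ _ _ u)

    members-size : ∀ {x z} (τ : Tri k x z) u → count (members τ u) ≤ suc (k + k)
    members-size (unit s) u = ℕ.≤-trans (D-step s) (s≤s z≤n)
    members-size {x} {z} (node {y = y} _ _ d d' l r) zero = ℕ.m≤n⇒m≤1+n (ℕ.≤-trans
      (count-subadditive (corner x y z) _ _ (λ c → ∨-bit (ins c x xor ins c y) _)) (ℕ.+-mono-≤ d d'))
      where
      ∨-bit : ∀ u v → bit (u ∨ v) ≤ bit u + bit v
      ∨-bit true v = s≤s z≤n
      ∨-bit false v = ℕ.≤-refl
    members-size (node _ _ _ _ l r) (suc i) with splitAt (suc (Rooted.size (tree l))) i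
    ... | inj₁ u = members-size l u
    ... | inj₂ u = members-size r u

    module _ {x y z : ℕ} (p : x < y) (q : y < z) (d : D x y ≤ k) (d' : D y z ≤ k)
             (l : Tri k x y) (r : Tri k y z) where
      private
        τ : Tri k x z
        τ = node p q d d' l r

      in-left : ∀ {c} → (∃ λ u → l ∋ c at u) → ∃ λ u → τ ∋ c at u
      in-left {c} (u , e) = left (tree l) (tree r) u , trans (cong (λ f → f c) (members-left p q d d' l r u)) e

      in-right : ∀ {c} → (∃ λ u → r ∋ c at u) → ∃ λ u → τ ∋ c at u
      in-right {c} (u , e) = right (tree l) (tree r) u , trans (cong (λ f → f c) (members-right p q d d' l r u)) e

      both-left : ∀ {c e} → (∃ λ u → l ∋ c at u × l ∋ e at u) → ∃ λ u → τ ∋ c at u × τ ∋ e at u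
      both-left {c} {e} (u , f , g) = left (tree l) (tree r) u
        , trans (cong (λ f → f c) (members-left p q d d' l r u)) f
        , trans (cong (λ f → f e) (members-left p q d d' l r u)) g

      both-right : ∀ {c e} → (∃ λ u → r ∋ c at u × r ∋ e at u) → ∃ λ u → τ ∋ c at u × τ ∋ e at u
      both-right {c} {e} (u , f , g) = right (tree l) (tree r) u
        , trans (cong (λ f → f c) (members-right p q d d' l r u)) f
        , trans (cong (λ f → f e) (members-right p q d d' l r u)) g

    at-endpoint : ∀ {x z c s} (τ : Tri k x z) → ins c s xor ins c (suc s) ≡ true → x ≤ s → s < z → ∃ λ u → τ ∋ c at u
    at-endpoint (unit s) e x≤s s<z with ℕ.≤-antisym x≤s (ℕ.≤-pred s<z)
    ... | refl = zero , e
    at-endpoint {s = s} (node {y = y} p q d d' l r) e x≤s s<z with ℕ.<-≤-connex s y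
    ... | inj₁ s<y = in-left p q d d' l r (at-endpoint l e x≤s s<y)
    ... | inj₂ y≤s = in-right p q d d' l r (at-endpoint r e y≤s s<z)

    corner₁ : ∀ {x y z c} → ins c x xor ins c y ≡ true → corner x y z c ≡ true
    corner₁ e rewrite e = refl

    corner₂ : ∀ {x y z c} → ins c y xor ins c z ≡ true → corner x y z c ≡ true
    corner₂ {x} {y} {z} {c} e rewrite e = Bool.∨-zeroʳ (ins c x xor ins c y)

    -- Descend to the triangle whose apex splits `e`. On whichever side of the apex `c` starts, it
    -- separates the apex from `x` or from `z`, because it is still open at `z`.
    common-rightward : ∀ {x z c e} (τ : Tri k x z) → x ≤ a e → a e < a c → a c < b e → b e < z → z ≤ b c →
                       ∃ λ u → τ ∋ c at u × τ ∋ e at u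
    common-rightward (unit s) p q r t u =
      ⊥-elim (ℕ.<⇒≱ (ℕ.<-trans q r) (ℕ.≤-trans (ℕ.≤-pred t) p))
    common-rightward {c = c} {e} (node {x} {y} {z} xy yz d d' l r') p q r t u
      with ℕ.<-≤-connex (a e) y | ℕ.<-≤-connex (b e) y
    ... | inj₂ y≤a | _ = both-right xy yz d d' l r' (common-rightward r' y≤a q r t u)
    ... | inj₁ _ | inj₁ b<y =
      both-left xy yz d d' l r' (common-rightward l p q r b<y (ℕ.≤-trans (ℕ.<⇒≤ yz) u))
    ... | inj₁ a<y | inj₂ y≤b = zero , c∈ , corner₁ {x} {y} {z} (false-xor-true (ins-before {e} p) (ins-true a<y y≤b))
      where
      c∈ : corner x y z c ≡ true
      c∈ with ℕ.<-≤-connex (a c) y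
      ... | inj₁ ac<y = corner₁ {x} {y} {z} (false-xor-true
        (ins-before {c} (ℕ.≤-trans p (ℕ.<⇒≤ q))) (ins-true ac<y (ℕ.≤-trans (ℕ.<⇒≤ yz) u)))
      ... | inj₂ y≤ac = corner₂ {x} {y} {z} (false-xor-true (ins-before {c} y≤ac) (ins-true (ℕ.<-trans r t) u))

    common-leftward : ∀ {x z c e} (τ : Tri k x z) → a c < x → x ≤ a e → a e < b c → b c < b e → b e < z →
                      ∃ λ u → τ ∋ c at u × τ ∋ e at u
    common-leftward (unit s) o p q r t =
      ⊥-elim (ℕ.<⇒≱ (ℕ.<-trans q r) (ℕ.≤-trans (ℕ.≤-pred t) p))
    common-leftward {c = c} {e} (node {x} {y} {z} xy yz d d' l r') o p q r t
      with ℕ.<-≤-connex (a e) y | ℕ.<-≤-connex (b e) y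
    ... | inj₂ y≤a | _ = both-right xy yz d d' l r' (common-leftward r' (ℕ.<-trans o xy) y≤a q r t)
    ... | inj₁ _ | inj₁ b<y = both-left xy yz d d' l r' (common-leftward l o p q r b<y)
    ... | inj₁ a<y | inj₂ y≤b = zero , c∈ , corner₁ {x} {y} {z} (false-xor-true (ins-before {e} p) (ins-true a<y y≤b))
      where
      c∈ : corner x y z c ≡ true
      c∈ with ℕ.<-≤-connex (b c) y
      ... | inj₁ bc<y = corner₁ {x} {y} {z} (true-xor-false (ins-true {c} o (ℕ.≤-trans p (ℕ.<⇒≤ q))) (ins-after bc<y))
      ... | inj₂ y≤bc = corner₂ {x} {y} {z} (true-xor-false
        (ins-true {c} (ℕ.<-trans o xy) y≤bc) (ins-after (ℕ.<-trans r t)))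

    -- Descend while both chords lie in the same half. An apex splitting both gives their triangle.
    -- An apex splitting only one leaves the other inside one half, out of which the split chord
    -- leads, and `common-rightward` or `common-leftward` takes over.
    common : ∀ {x z c e} (τ : Tri k x z) → x ≤ a c → a c < a e → a e < b c → b c < b e → b e < z →
             ∃ λ u → τ ∋ c at u × τ ∋ e at u
    common (unit s) p q r t u =
      ⊥-elim (ℕ.<⇒≱ (ℕ.<-trans q (ℕ.<-trans r t)) (ℕ.≤-trans (ℕ.≤-pred u) p))
    common {c = c} {e} (node {x} {y} {z} xy yz d d' l r') p q r t u
      with ℕ.<-≤-connex (a c) y | ℕ.<-≤-connex (b e) y
    ... | inj₂ y≤a | _ = both-right xy yz d d' l r' (common r' y≤a q r t u)
    ... | _ | inj₁ b<y = both-left xy yz d d' l r' (common l p q r t b<y)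
    ... | inj₁ ac<y | inj₂ y≤be with ℕ.<-≤-connex (a e) y | ℕ.<-≤-connex (b c) y
    ...   | inj₂ y≤ae | _ = both-right xy yz d d' l r' (common-leftward r' ac<y y≤ae r t u)
    ...   | inj₁ _ | inj₁ bc<y = both-left xy yz d d' l r' (swap (common-rightward l p q r bc<y y≤be))
      where
      swap : ∀ {P Q : Fin _ → Set} → (∃ λ u → P u × Q u) → ∃ λ u → Q u × P u
      swap (u , p , q) = u , q , p
    ...   | inj₁ ae<y | inj₂ y≤bc = zero
          , corner₁ {x} {y} {z} (false-xor-true (ins-before {c} p) (ins-true ac<y y≤bc))
          , corner₁ {x} {y} {z} (false-xor-true (ins-before {e} (ℕ.≤-trans p (ℕ.<⇒≤ q))) (ins-true ae<y y≤be))

    at-root : ∀ {x z c} (τ : Tri k x z) → ins c x xor ins c z ≡ true → τ ∋ c at zero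
    at-root (unit s) e = e
    at-root {c = c} (node {x} {y} {z} _ _ _ _ l r) e with ins c x | ins c y | ins c z
    ... | true | false | _ = refl
    ... | false | true | _ = refl
    ... | true | true | _ = e
    ... | false | false | _ = e

    varies : ∀ {x z c} (τ : Tri k x z) u → τ ∋ c at u → ∃ λ w → x ≤ w × w ≤ z × ins c x xor ins c w ≡ true
    varies (unit s) u e = suc s , ℕ.n≤1+n s , ℕ.≤-refl , e
    varies {c = c} (node {x} {y} {z} xy yz d d' l r) u e with position (tree l) (tree r) u
    ... | root with ins c x xor ins c y in eq
    ...   | true = y , ℕ.<⇒≤ xy , ℕ.<⇒≤ yz , eq
    ...   | false = z , ℕ.<⇒≤ (ℕ.<-trans xy yz) , ℕ.≤-refl
                  , trans (cong (_xor ins c z) (xor-false⇒≡ {ins c x} eq)) e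
    varies {c = c} (node {x} {y} {z} xy yz d d' l r) _ e | leftₚ u
      with varies l u (trans (cong (λ f → f c) (sym (members-left xy yz d d' l r u))) e)
    ... | w , p , q , f = w , p , ℕ.≤-trans q (ℕ.<⇒≤ yz) , f
    varies {c = c} (node {x} {y} {z} xy yz d d' l r) _ e | rightₚ u
      with varies r u (trans (cong (λ f → f c) (sym (members-right xy yz d d' l r u))) e)
    ... | w , p , q , f with ins c x xor ins c y in eq
    ...   | true = y , ℕ.<⇒≤ xy , ℕ.<⇒≤ yz , eq
    ...   | false = w , ℕ.≤-trans (ℕ.<⇒≤ xy) p , q , trans (cong (_xor ins c w) (xor-false⇒≡ {ins c x} eq)) f

    module _ {x y z : ℕ} (xy : x < y) (yz : y < z) (d : D x y ≤ k) (d' : D y z ≤ k)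
             (l : Tri k x y) (r : Tri k y z) (c : Fin (n G)) where
      private
        τ : Tri k x z
        τ = node xy yz d d' l r
        L = left (tree l) (tree r)
        R = right (tree l) (tree r)

      leftwards : ∀ {u} → τ ∋ c at L u → l ∋ c at u
      leftwards {u} = trans (cong (λ f → f c) (sym (members-left xy yz d d' l r u)))

      rightwards : ∀ {u} → τ ∋ c at R u → r ∋ c at u
      rightwards {u} = trans (cong (λ f → f c) (sym (members-right xy yz d d' l r u)))

      lift-left : ∀ {u v} → WalkIn (T l) (l ∋ c at_) u v → WalkIn (T τ) (τ ∋ c at_) (L u) (L v)
      lift-left = walk-image L (left-edge (tree l) (tree r))
        (λ {u} → trans (cong (λ f → f c) (members-left xy yz d d' l r u)))

      lift-right : ∀ {u v} → WalkIn (T r) (r ∋ c at_) u v → WalkIn (T τ) (τ ∋ c at_) (R u) (R v)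
      lift-right = walk-image R (right-edge (tree l) (tree r))
        (λ {u} → trans (cong (λ f → f c) (members-right xy yz d d' l r u)))

      not-both : ins c x xor ins c y ≡ false → ∀ u v → l ∋ c at u → r ∋ c at v → ⊥
      not-both eq u v e f with xor-false⇒≡ {ins c x} eq | varies l u e | varies r v f
      ... | xy≡ | w , p , q , g | w' , p' , q' , g' =
        no-alternation {c} {ins c x} {x} {w} {y} {w'} p q p' refl (xor-true⇒not g) (sym xy≡)
          (trans (xor-true⇒not g') (cong not (sym xy≡)))

      left-crosses : corner x y z c ≡ true → ∀ u → l ∋ c at u → ins c x xor ins c y ≡ true
      left-crosses cor u e with ins c x xor ins c y in eq
      ... | true = refl
      ... | false with xor-false⇒≡ {ins c x} eq | varies l u e
      ...   | xy≡ | w , p , q , g =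
        ⊥-elim (no-alternation {c} {ins c x} {x} {w} {y} {z} p q (ℕ.<⇒≤ yz) refl (xor-true⇒not g) (sym xy≡)
          (trans (xor-true⇒not cor) (cong not (sym xy≡))))

      right-crosses : corner x y z c ≡ true → ∀ u → r ∋ c at u → ins c y xor ins c z ≡ true
      right-crosses cor u e with ins c y xor ins c z in eq
      ... | true = refl
      ... | false with xor-false⇒≡ {ins c y} eq | varies r u e
      ...   | yz≡ | w , p , q , g =
        ⊥-elim (no-alternation {c} {ins c x} {x} {y} {w} {z} (ℕ.<⇒≤ xy) p q refl xy≢
          (trans (xor-true⇒not g) (trans (cong not xy≢) (Bool.not-involutive _))) (trans (sym yz≡) xy≢))
        where
        xy≢ : ins c y ≡ not (ins c x)
        xy≢ = xor-true⇒not (trans (sym (Bool.∨-identityʳ _)) cor)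

      to-root-left : ins c x xor ins c y ≡ true → ConnectedIn (T l) (l ∋ c at_) → ∀ u → l ∋ c at u →
                     WalkIn (T τ) (τ ∋ c at_) (L u) zero
      to-root-left eq conn u e = walk-++ (lift-left (conn u zero e (at-root l eq)))
        (step (trans (cong (λ f → f c) (members-left xy yz d d' l r zero)) (at-root l eq))
          (E-sym (T τ) (root-left (tree l) (tree r))) (here (corner₁ {x} {y} {z} eq)))

      to-root-right : ins c y xor ins c z ≡ true → ConnectedIn (T r) (r ∋ c at_) → ∀ u → r ∋ c at u →
                      WalkIn (T τ) (τ ∋ c at_) (R u) zero
      to-root-right eq conn u e = walk-++ (lift-right (conn u zero e (at-root r eq)))
        (step (trans (cong (λ f → f c) (members-right xy yz d d' l r zero)) (at-root r eq))
          (E-sym (T τ) (root-right (tree l) (tree r))) (here (corner₂ {x} {y} {z} eq)))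

      -- If the triangle contains `c`, an occurrence of `c` in a subtree forces `c` to separate the
      -- ends of that subtree's interval, so `c` is at the subtree's root, next to the triangle. If
      -- not, `c` has the same side at all three corners and occurs in at most one subtree.
      connect : ConnectedIn (T l) (l ∋ c at_) → ConnectedIn (T r) (r ∋ c at_) → ConnectedIn (T τ) (τ ∋ c at_)
      connect connL connR u v u∋ v∋ with corner x y z c in cor
      ... | true = walk-++ (up u u∋) (walk-rev (up v v∋))
        where
        up : ∀ u → τ ∋ c at u → WalkIn (T τ) (τ ∋ c at_) u zero
        up u e with position (tree l) (tree r) u
        ... | root = here cor
        ... | leftₚ u' = to-root-left (left-crosses cor u' (leftwards e)) connL u' (leftwards e)
        ... | rightₚ u' = to-root-right (right-crosses cor u' (rightwards e)) connR u' (rightwards e)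
      ... | false with position (tree l) (tree r) u | position (tree l) (tree r) v
      ...   | root | _ with () ← trans (sym cor) u∋
      ...   | _ | root with () ← trans (sym cor) v∋
      ...   | leftₚ u' | leftₚ v' = lift-left (connL u' v' (leftwards u∋) (leftwards v∋))
      ...   | rightₚ u' | rightₚ v' = lift-right (connR u' v' (rightwards u∋) (rightwards v∋))
      ...   | leftₚ u' | rightₚ v' = ⊥-elim (not-both (∨-false⁻ˡ cor) u' v' (leftwards u∋) (rightwards v∋))
      ...   | rightₚ u' | leftₚ v' = ⊥-elim (not-both (∨-false⁻ˡ cor) v' u' (leftwards v∋) (rightwards u∋))

    connected-at : ∀ {x z} (τ : Tri k x z) c → ConnectedIn (T τ) (τ ∋ c at_)
    connected-at (unit s) c zero zero p q = here p
    connected-at (node p q d d' l r) c = connect p q d d' l r c (connected-at l c) (connected-at r c)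

    tri⇒decomposition : ∀ {N} → (∀ c → b c < N) → Tri k 0 N → TreeDecomp G (k + k)
    tri⇒decomposition {N} b<N τ = record
      { T = T τ
      ; tree = rooted-tree (tree τ)
      ; bag = λ u → tabulate (members τ u)
      ; cover-v = λ c → let u , e = at-endpoint {s = a c} τ
                                      (false-xor-true (ins-before {c} ℕ.≤-refl) (ins-true {c} ℕ.≤-refl (a<b c)))
                                      z≤n (ℕ.<-trans (a<b c) (b<N c))
                        in u , ∈-tabulate⁺ (members τ u) e
      ; cover-e = λ c e adj → let u , p , q = edge (E⇒ adj)
                              in u , ∈-tabulate⁺ (members τ u) p , ∈-tabulate⁺ (members τ u) q
      ; coherent = λ c u v p q → walk-map (λ w → ∈-tabulate⁺ (members τ w))
                     (connected-at τ c u v (∈-tabulate⁻ (members τ u) p) (∈-tabulate⁻ (members τ v) q))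
      ; width = λ u → subst (_≤ suc (k + k)) (sym (∣tabulate∣ (members τ u))) (members-size τ u)
      }
      where
      edge : ∀ {c e} → Crosses (a c) (b c) (a e) (b e) → ∃ λ u → τ ∋ c at u × τ ∋ e at u
      edge {c} {e} (inj₁ (p , q , r)) = common τ z≤n p q r (b<N e)
      edge {c} {e} (inj₂ (p , q , r)) = let u , f , g = common τ z≤n p q r (b<N c) in u , g , f

-- Sperner's argument

majority : Bool → Bool → Bool → Bool
majority true v w = v ∨ w
majority false v w = v ∧ w

maj-lipschitz₂ : ∀ u v v' w → bit (majority u v w xor majority u v' w) ≤ bit (v xor v')
maj-lipschitz₂ true true true w = ℕ.≤-refl
maj-lipschitz₂ true true false true = z≤n
maj-lipschitz₂ true true false false = ℕ.≤-refl
maj-lipschitz₂ true false true true = z≤n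
maj-lipschitz₂ true false true false = ℕ.≤-refl
maj-lipschitz₂ true false false true = z≤n
maj-lipschitz₂ true false false false = z≤n
maj-lipschitz₂ false true true true = z≤n
maj-lipschitz₂ false true true false = z≤n
maj-lipschitz₂ false true false true = ℕ.≤-refl
maj-lipschitz₂ false true false false = z≤n
maj-lipschitz₂ false false true true = ℕ.≤-refl
maj-lipschitz₂ false false true false = z≤n
maj-lipschitz₂ false false false w = z≤n

maj-swap : ∀ u v w → majority u v w ≡ majority u w v
maj-swap true v w = Bool.∨-comm v w
maj-swap false v w = Bool.∧-comm v w

maj-repeat : ∀ u v → majority u v v ≡ v
maj-repeat true v = Bool.∨-idem v
maj-repeat false v = Bool.∧-idem v

maj-repeatˡ : ∀ u w → majority u u w ≡ u
maj-repeatˡ true w = refl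
maj-repeatˡ false w = refl

maj-between : ∀ u v w → bit (majority u v w xor u) + bit (majority u v w xor w) ≤ bit (u xor w)
maj-between true true true = z≤n
maj-between true true false = ℕ.≤-refl
maj-between true false true = z≤n
maj-between true false false = ℕ.≤-refl
maj-between false true true = ℕ.≤-refl
maj-between false true false = z≤n
maj-between false false true = ℕ.≤-refl
maj-between false false false = z≤n

hamming-zero : ∀ {m} (x y : Fin m → Bool) {k} → (∀ c → x c ≡ y c) → hamming x y ≤ k
hamming-zero {zero} x y e = z≤n
hamming-zero {suc m} x y e rewrite e zero | Bool.xor-same (y zero) = hamming-zero (x ∘ suc) (y ∘ suc) (e ∘ suc)

half : ∀ {u v h} → u + v ≤ h + h → u ≤ h ⊎ v ≤ h
half {u} {v} {h} q with u ≤? h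
... | yes p = inj₁ p
... | no ¬p = inj₂ (ℕ.+-cancelˡ-≤ h v h (ℕ.≤-trans (ℕ.+-monoˡ-≤ v (ℕ.<⇒≤ (ℕ.≰⇒> ¬p))) q))

median : ∀ {m} → (Fin m → Bool) → (Fin m → Bool) → (Fin m → Bool) → Fin m → Bool
median x y z c = majority (x c) (y c) (z c)

module Triangulation {G : Graph} (Δ : Diagram G) (N r : ℕ) where
  open Gaps Δ

  -- `k` is 4r + 4. The medians at the corners of a small triangle are at most 2 apart, so gaps
  -- within `r` of them are at most `h` apart. A point on a geodesic of length at most `k` is within
  -- `h` of one of its ends; a label reached through an end is thus up to `h + r` away, and r + 2 +
  -- (h + r) equals `k`.
  h k : ℕ
  h = suc (suc (r + r))
  k = h + h

  Near : Set
  Near = ∀ {α β γ} → α < suc N → β < suc N → γ < suc N →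
         ∃ λ s → s < suc N × hamming (median (gap α) (gap β) (gap γ)) (gap s) ≤ r

  D-sym : ∀ s t → D s t ≤ D t s
  D-sym s t = hamming-sym (gap s) (gap t)

  module Stuck (near : Near) (p q : ℕ) (p+1<q : suc p < q) (q≤N : q ≤ N) (Dpq : D p q ≤ k)
               (stuck : ∀ y → p < y → y < q → D p y ≤ k → D y q ≤ k → ⊥) where

    p<q : p < q
    p<q = ℕ.<-trans ℕ.≤-refl p+1<q

    pt : ℕ → ℕ → Fin (n G) → Bool
    pt i j = median (gap p) (gap i) (gap j)

    pt-stepʲ : ∀ i j → hamming (pt i j) (pt i (suc j)) ≤ 1
    pt-stepʲ i j = ℕ.≤-trans (count-mono _ _ (λ c → subst
      (λ b → bit b ≤ bit (ins c j xor ins c (suc j)))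
      (cong₂ _xor_ (maj-swap (ins c p) (ins c j) (ins c i)) (maj-swap (ins c p) (ins c (suc j)) (ins c i)))
      (maj-lipschitz₂ (ins c p) (ins c j) (ins c (suc j)) (ins c i)))) (D-step j)

    pt-stepⁱ : ∀ i j → hamming (pt i j) (pt (suc i) j) ≤ 1
    pt-stepⁱ i j = ℕ.≤-trans
      (count-mono _ _ (λ c → maj-lipschitz₂ (ins c p) (ins c i) (ins c (suc i)) (ins c j))) (D-step i)

    pt-diag : ∀ i j → hamming (pt i j) (pt (suc i) (suc j)) ≤ 2
    pt-diag i j = ℕ.≤-trans (hamming-triangle (pt i j) (pt (suc i) j) (pt (suc i) (suc j)))
                            (ℕ.+-mono-≤ (pt-stepⁱ i j) (pt-stepʲ (suc i) j))

    -- The boundary conditions of Sperner's lemma on the triangle p ≤ i ≤ j ≤ q, with the colours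
    -- `p`, `q` and everything else. The weaker closeness is granted only to the labels `p` and `q`,
    -- whose mutual distance is bounded by `Dpq`.
    record Label (i j l : ℕ) : Set where
      field
        p≤l : p ≤ l
        l≤q : l ≤ q
        close : hamming (pt i j) (gap l) ≤ r ⊎ ((l ≡ p ⊎ l ≡ q) × hamming (pt i j) (gap l) ≤ h + r)
        side : i ≡ p → l ≡ p
        diag : i ≡ j → l ≡ i
        top : j ≡ q → l ≡ p ⊎ l ≡ q

    between : ∀ z → hamming z (gap p) + hamming z (gap q) ≤ D p q →
              ∃ λ l → (l ≡ p ⊎ l ≡ q) × hamming z (gap l) ≤ h
    between z e with half {h = h} (ℕ.≤-trans e Dpq)
    ... | inj₁ f = p , inj₁ refl , f
    ... | inj₂ f = q , inj₂ refl , f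

    end-range : ∀ {l} → l ≡ p ⊎ l ≡ q → p ≤ l × l ≤ q
    end-range (inj₁ refl) = ℕ.≤-refl , ℕ.<⇒≤ p<q
    end-range (inj₂ refl) = ℕ.<⇒≤ p<q , ℕ.≤-refl

    -- If the gap s near pt i j is outside [p,q], no chord separates {i,s} from {p,q}, so the median of
    -- pt i j, p and q lies on a geodesic from pt i j to s.
    detour : ∀ {i j s} → p ≤ i → i ≤ j → j ≤ q → s < p ⊎ q < s →
             hamming (pt i j) (median (gap p) (pt i j) (gap q)) ≤ hamming (pt i j) (gap s)
    detour {i} {j} {s} p≤i i≤j j≤q out = count-mono _ _ pointwise
      where
      i≤q : i ≤ q
      i≤q = ℕ.≤-trans i≤j j≤q
      alternates : s < p ⊎ q < s → ∀ c β → ins c p ≡ β → ins c i ≡ not β → ins c q ≡ β → ins c s ≡ not β → ⊥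
      alternates (inj₁ s<p) c β ep ei eq es =
        no-alternation {c} {not β} (ℕ.<⇒≤ s<p) p≤i i≤q es (trans ep (sym (Bool.not-involutive β))) ei
                         (trans eq (sym (Bool.not-involutive β)))
      alternates (inj₂ q<s) c β ep ei eq es = no-alternation {c} {β} p≤i i≤q (ℕ.<⇒≤ q<s) ep ei eq es
      pointwise : ∀ c → bit (pt i j c xor majority (ins c p) (pt i j c) (ins c q)) ≤ bit (pt i j c xor ins c s)
      pointwise c with ins c p in ep | ins c i in ei | ins c j | ins c q in eq | ins c s in es
      ... | true | true | _ | _ | _ = z≤n
      ... | true | false | true | _ | _ = z≤n
      ... | true | false | false | false | _ = z≤n
      ... | true | false | false | true | true = s≤s z≤n
      ... | true | false | false | true | false = ⊥-elim (alternates out c true ep ei eq es)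
      ... | false | false | _ | _ | _ = z≤n
      ... | false | true | false | _ | _ = z≤n
      ... | false | true | true | true | _ = z≤n
      ... | false | true | true | false | false = s≤s z≤n
      ... | false | true | true | false | true = ⊥-elim (alternates out c false ep ei eq es)

    -- The detour costs at most `r`, and the median it reaches lies on a geodesic between `p` and
    -- `q`, hence within `h` of one of them.
    via-end : ∀ {i j s} → p ≤ i → i ≤ j → j ≤ q → s < p ⊎ q < s → hamming (pt i j) (gap s) ≤ r →
              ∃ λ l → (l ≡ p ⊎ l ≡ q) × hamming (pt i j) (gap l) ≤ h + r
    via-end {i} {j} p≤i i≤j j≤q out close
      with between (median (gap p) (pt i j) (gap q))
             (count-superadditive _ _ _ (λ c → maj-between (ins c p) (pt i j c) (ins c q)))
    ... | l , l∈ , cl = l , l∈ , ℕ.≤-trans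
      (hamming-triangle (pt i j) (median (gap p) (pt i j) (gap q)) (gap l))
      (ℕ.≤-trans (ℕ.+-mono-≤ (ℕ.≤-trans (detour p≤i i≤j j≤q out) close) cl) (ℕ.≤-reflexive (ℕ.+-comm r h)))

    end-label : ∀ {i j} → i ≢ p → i ≢ j → j ≢ q →
                (∃ λ l → (l ≡ p ⊎ l ≡ q) × hamming (pt i j) (gap l) ≤ h + r) → ∃ (Label i j)
    end-label i≢p i≢j j≢q (l , l∈ , close) = l , record
      { p≤l = proj₁ (end-range l∈) ; l≤q = proj₂ (end-range l∈) ; close = inj₂ (l∈ , close)
      ; side = ⊥-elim ∘ i≢p ; diag = ⊥-elim ∘ i≢j ; top = ⊥-elim ∘ j≢q }

    label : ∀ {i j} → p ≤ i → i ≤ j → j ≤ q → ∃ (Label i j)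
    label {i} {j} p≤i i≤j j≤q with i ℕ.≟ p
    ... | yes refl = p , record
      { p≤l = ℕ.≤-refl ; l≤q = ℕ.<⇒≤ p<q
      ; close = inj₁ (hamming-zero _ _ (λ c → maj-repeatˡ (ins c p) (ins c j)))
      ; side = λ _ → refl ; diag = λ _ → refl ; top = λ _ → inj₁ refl }
    ... | no i≢p with i ℕ.≟ j
    ...   | yes refl = i , record
      { p≤l = p≤i ; l≤q = j≤q
      ; close = inj₁ (hamming-zero _ _ (λ c → maj-repeat (ins c p) (ins c j)))
      ; side = λ e → e ; diag = λ _ → refl ; top = inj₂ }
    ...   | no i≢j with j ℕ.≟ q
    ...     | yes refl with between (pt i q)
                (count-superadditive _ _ _ (λ c → maj-between (ins c p) (ins c i) (ins c q)))
    ...       | l , l∈ , close = l , record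
      { p≤l = proj₁ (end-range l∈) ; l≤q = proj₂ (end-range l∈)
      ; close = inj₂ (l∈ , ℕ.≤-trans close (ℕ.m≤m+n h r))
      ; side = ⊥-elim ∘ i≢p ; diag = ⊥-elim ∘ i≢j ; top = λ _ → l∈ }
    label {i} {j} p≤i i≤j j≤q | no i≢p | no i≢j | no j≢q
      with near (s≤s (ℕ.≤-trans (ℕ.<⇒≤ p<q) q≤N)) (s≤s (ℕ.≤-trans (ℕ.≤-trans i≤j j≤q) q≤N)) (s≤s (ℕ.≤-trans j≤q q≤N))
    ... | s , _ , close with ℕ.<-≤-connex s p | ℕ.<-≤-connex q s
    ...   | inj₂ p≤s | inj₂ s≤q = s , record
      { p≤l = p≤s ; l≤q = s≤q ; close = inj₁ close
      ; side = ⊥-elim ∘ i≢p ; diag = ⊥-elim ∘ i≢j ; top = ⊥-elim ∘ j≢q }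
    ...   | inj₁ s<p | _ = end-label i≢p i≢j j≢q (via-end p≤i i≤j j≤q (inj₁ s<p) close)
    ...   | inj₂ _ | inj₁ q<s = end-label i≢p i≢j j≢q (via-end p≤i i≤j j≤q (inj₂ q<s) close)

    -- Outside the triangle the label is the dummy value `p`; this makes `lab` a function of the
    -- indices alone.
    total-label : ∀ i j → ∃ λ l → p ≤ i → i ≤ j → j ≤ q → Label i j l
    total-label i j with p ≤? i | i ≤? j | j ≤? q
    ... | yes p≤i | yes i≤j | yes j≤q = let l , L = label p≤i i≤j j≤q in l , λ _ _ _ → L
    ... | no ¬e | _ | _ = p , λ e _ _ → ⊥-elim (¬e e)
    ... | _ | no ¬e | _ = p , λ _ e _ → ⊥-elim (¬e e)
    ... | _ | _ | no ¬e = p , λ _ _ e → ⊥-elim (¬e e)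

    lab : ℕ → ℕ → ℕ
    lab i j = proj₁ (total-label i j)

    lab-ok : ∀ {i j} → p ≤ i → i ≤ j → j ≤ q → Label i j (lab i j)
    lab-ok {i} {j} = proj₂ (total-label i j)

    through : ∀ x y l l' {u v w} → hamming x (gap l) ≤ u → hamming x y ≤ v → hamming y (gap l') ≤ w →
              D l l' ≤ u + (v + w)
    through x y l l' e f g = ℕ.≤-trans (hamming-triangle (gap l) x (gap l'))
      (ℕ.+-mono-≤ (ℕ.≤-trans (hamming-sym (gap l) x) e)
        (ℕ.≤-trans (hamming-triangle x y (gap l')) (ℕ.+-mono-≤ f g)))

    ends-near : ∀ {l l'} → l ≡ p ⊎ l ≡ q → l' ≡ p ⊎ l' ≡ q → D l l' ≤ k
    ends-near (inj₁ refl) (inj₁ refl) = hamming-zero (gap p) (gap p) (λ _ → refl)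
    ends-near (inj₁ refl) (inj₂ refl) = Dpq
    ends-near (inj₂ refl) (inj₁ refl) = ℕ.≤-trans (D-sym q p) Dpq
    ends-near (inj₂ refl) (inj₂ refl) = hamming-zero (gap q) (gap q) (λ _ → refl)

    labels-near : ∀ {i j l i' j' l'} → Label i j l → Label i' j' l' → hamming (pt i j) (pt i' j') ≤ 2 → D l l' ≤ k
    labels-near {i} {j} {l} {i'} {j'} {l'} L L' e with Label.close L | Label.close L'
    ... | inj₁ c | inj₁ c' = ℕ.≤-trans (through (pt i j) (pt i' j') l l' c e c')
          (ℕ.≤-trans (ℕ.≤-reflexive (sum₀ r)) (ℕ.m≤m+n h h))
      where
      sum₀ : ∀ r → r + (2 + r) ≡ suc (suc (r + r))
      sum₀ r = trans (ℕ.+-suc r (suc r)) (cong suc (ℕ.+-suc r r))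
    ... | inj₂ (x , _) | inj₂ (y , _) = ends-near x y
    ... | inj₁ c | inj₂ (_ , c') = ℕ.≤-trans (through (pt i j) (pt i' j') l l' c e c') (ℕ.≤-reflexive sum₁)
      where
      sum₁ : r + (2 + (h + r)) ≡ h + h
      sum₁ = trans (cong (λ t → r + (2 + t)) (ℕ.+-comm h r))
        (trans (sym (ℕ.+-assoc r 2 (r + h))) (trans (cong (_+ (r + h)) (ℕ.+-comm r 2))
          (trans (sym (ℕ.+-assoc (2 + r) r h)) refl)))
    ... | inj₂ (_ , c) | inj₁ c' = ℕ.≤-trans (through (pt i j) (pt i' j') l l' c e c') (ℕ.≤-reflexive sum₂)
      where
      sum₂ : h + r + (2 + r) ≡ h + h
      sum₂ = trans (ℕ.+-assoc h r (2 + r)) (cong (h +_) (trans (ℕ.+-suc r (suc r)) (cong suc (ℕ.+-suc r r))))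

    data Kind : Set where
      P Q O : Kind

    kind : ℕ → Kind
    kind l with l ℕ.≟ p | l ℕ.≟ q
    ... | yes _ | _ = P
    ... | no _ | yes _ = Q
    ... | no _ | no _ = O

    kind-P⁻ : ∀ {l} → kind l ≡ P → l ≡ p
    kind-P⁻ {l} e with l ℕ.≟ p | l ℕ.≟ q
    ... | yes f | _ = f
    kind-P⁻ () | no _ | yes _
    kind-P⁻ () | no _ | no _

    kind-Q⁻ : ∀ {l} → kind l ≡ Q → l ≡ q
    kind-Q⁻ {l} e with l ℕ.≟ p | l ℕ.≟ q
    kind-Q⁻ () | yes _ | _
    ... | no _ | yes f = f
    kind-Q⁻ () | no _ | no _

    kind-O⁻ : ∀ {l} → kind l ≡ O → l ≢ p × l ≢ q
    kind-O⁻ {l} e with l ℕ.≟ p | l ℕ.≟ q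
    kind-O⁻ () | yes _ | _
    kind-O⁻ () | no _ | yes _
    ... | no f | no g = f , g

    kind-p : kind p ≡ P
    kind-p with p ℕ.≟ p | p ℕ.≟ q
    ... | yes _ | _ = refl
    ... | no ne | _ = ⊥-elim (ne refl)

    kind-q : kind q ≡ Q
    kind-q with q ℕ.≟ p | q ℕ.≟ q
    ... | yes e | _ = ⊥-elim (ℕ.<⇒≢ p<q (sym e))
    ... | no _ | yes _ = refl
    ... | no _ | no ne = ⊥-elim (ne refl)

    -- Marks the edges between the colours `P` and `Q`, the doors of Sperner's argument.
    ω : Kind → Kind → Bool
    ω P Q = true
    ω Q P = true
    ω _ _ = false

    no-rainbow : ∀ {i j l m m'} → Label i j l → kind l ≡ O → kind m ≡ P → kind m' ≡ Q →
                 D m l ≤ k → D l m' ≤ k → ⊥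
    no-rainbow {l = l} L o π κ e f with kind-P⁻ π | kind-Q⁻ κ | kind-O⁻ o
    ... | refl | refl | l≢p , l≢q =
      stuck l (ℕ.≤∧≢⇒< (Label.p≤l L) (l≢p ∘ sym)) (ℕ.≤∧≢⇒< (Label.l≤q L) l≢q) e f

    -- A triangle has an odd number of doors only if it carries all three colours; its third label
    -- would then be the missing apex.
    triangle : ∀ {i₁ j₁ l₁ i₂ j₂ l₂ i₃ j₃ l₃} → Label i₁ j₁ l₁ → Label i₂ j₂ l₂ → Label i₃ j₃ l₃ →
               D l₁ l₂ ≤ k → D l₂ l₃ ≤ k → D l₁ l₃ ≤ k →
               ω (kind l₁) (kind l₂) xor ω (kind l₂) (kind l₃) ≡ ω (kind l₁) (kind l₃)
    triangle {l₁ = l₁} {l₂ = l₂} {l₃ = l₃} L₁ L₂ L₃ e f g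
      with kind l₁ in k₁ | kind l₂ in k₂ | kind l₃ in k₃
    ... | P | P | _ = refl
    ... | Q | Q | _ = refl
    ... | O | O | _ = refl
    ... | P | Q | P = refl
    ... | P | Q | Q = refl
    ... | P | Q | O = ⊥-elim (no-rainbow L₃ k₃ k₁ k₂ g (ℕ.≤-trans (D-sym l₃ l₂) f))
    ... | P | O | P = refl
    ... | P | O | Q = ⊥-elim (no-rainbow L₂ k₂ k₁ k₃ e f)
    ... | P | O | O = refl
    ... | Q | P | P = refl
    ... | Q | P | Q = refl
    ... | Q | P | O = ⊥-elim (no-rainbow L₃ k₃ k₂ k₁ f (ℕ.≤-trans (D-sym l₃ l₁) g))
    ... | Q | O | P = ⊥-elim (no-rainbow L₂ k₂ k₃ k₁ (ℕ.≤-trans (D-sym l₃ l₂) f) (ℕ.≤-trans (D-sym l₂ l₁) e))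
    ... | Q | O | Q = refl
    ... | Q | O | O = refl
    ... | O | P | P = refl
    ... | O | P | Q = ⊥-elim (no-rainbow L₁ k₁ k₂ k₃ (ℕ.≤-trans (D-sym l₂ l₁) e) g)
    ... | O | P | O = refl
    ... | O | Q | P = ⊥-elim (no-rainbow L₁ k₁ k₃ k₂ (ℕ.≤-trans (D-sym l₃ l₁) g) e)
    ... | O | Q | Q = refl
    ... | O | Q | O = refl

    W : ℕ → ℕ → ℕ → ℕ → Bool
    W i j i' j' = ω (kind (lab i j)) (kind (lab i' j'))

    -- Parity of the {p,q}-edges among the first d edges of row j.
    U : ℕ → ℕ → Bool
    U zero j = false
    U (suc d) j = U d j xor W (d + p) j (suc d + p) j

    lab-side : ∀ {j} → p ≤ j → j ≤ q → lab p j ≡ p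
    lab-side p≤j j≤q = Label.side (lab-ok ℕ.≤-refl p≤j j≤q) refl

    square : ∀ u v ab bc ac ad dc → u xor v ≡ ad → ab xor bc ≡ ac → ad xor dc ≡ ac →
             (u xor ab) xor (v xor dc) ≡ bc
    square u v ab bc _ _ dc refl refl e = begin
      (u xor ab) xor (v xor dc)   ≡⟨ Bool.xor-assoc u ab (v xor dc) ⟩
      u xor (ab xor (v xor dc))   ≡⟨ cong (u xor_) (sym (Bool.xor-assoc ab v dc)) ⟩
      u xor ((ab xor v) xor dc)   ≡⟨ cong (λ t → u xor (t xor dc)) (Bool.xor-comm ab v) ⟩
      u xor ((v xor ab) xor dc)   ≡⟨ cong (u xor_) (Bool.xor-assoc v ab dc) ⟩
      u xor (v xor (ab xor dc))   ≡⟨ cong (λ t → u xor (v xor t)) (Bool.xor-comm ab dc) ⟩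
      u xor (v xor (dc xor ab))   ≡⟨ sym (Bool.xor-assoc u v (dc xor ab)) ⟩
      (u xor v) xor (dc xor ab)   ≡⟨ sym (Bool.xor-assoc (u xor v) dc ab) ⟩
      ((u xor v) xor dc) xor ab   ≡⟨ cong (_xor ab) e ⟩
      (ab xor bc) xor ab          ≡⟨ Bool.xor-comm (ab xor bc) ab ⟩
      ab xor (ab xor bc)          ≡⟨ sym (Bool.xor-assoc ab ab bc) ⟩
      (ab xor ab) xor bc          ≡⟨ cong (_xor bc) (Bool.xor-same ab) ⟩
      bc                          ∎
      where open ≡-Reasoning

    -- Induction over the columns: a unit square is cut by its diagonal into two triangles, each
    -- with an even number of doors. The left boundary has a single label and therefore no doors.
    rows : ∀ d j → d + p ≤ j → suc j ≤ q → U d j xor U d (suc j) ≡ W (d + p) j (d + p) (suc j)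
    rows zero j p≤j j<q rewrite lab-side p≤j (ℕ.<⇒≤ j<q) | lab-side (ℕ.m≤n⇒m≤1+n p≤j) j<q | kind-p = refl
    rows (suc d) j d<j j<q = square (U d j) (U d (suc j)) _ _ _ _ _ (rows d j i≤j j<q)
        (triangle A B C (labels-near A B (ℕ.m≤n⇒m≤1+n (pt-stepⁱ i j)))
                  (labels-near B C (ℕ.m≤n⇒m≤1+n (pt-stepʲ (suc i) j)))
                  (labels-near A C (pt-diag i j)))
        (triangle A H C (labels-near A H (ℕ.m≤n⇒m≤1+n (pt-stepʲ i j)))
                  (labels-near H C (ℕ.m≤n⇒m≤1+n (pt-stepⁱ i (suc j))))
                  (labels-near A C (pt-diag i j)))
      where
      i = d + p
      p≤i = ℕ.m≤n+m p d
      i≤j = ℕ.<⇒≤ d<j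
      j≤q = ℕ.<⇒≤ j<q
      A = lab-ok p≤i i≤j j≤q
      B = lab-ok (ℕ.m≤n⇒m≤1+n p≤i) d<j j≤q
      C = lab-ok (ℕ.m≤n⇒m≤1+n p≤i) (ℕ.m≤n⇒m≤1+n d<j) j<q
      H = lab-ok p≤i (ℕ.m≤n⇒m≤1+n i≤j) j<q

    lab-diag : ∀ {i} → p ≤ i → i ≤ q → lab i i ≡ i
    lab-diag p≤i i≤q = Label.diag (lab-ok p≤i ℕ.≤-refl i≤q) refl

    -- The diagonal carries its own indices as labels, so a door on it would make `p` and `q`
    -- neighbours; this is where `p+1<q` enters.
    consecutive : ∀ j → ω (kind j) (kind (suc j)) ≡ false
    consecutive j with kind j in e | kind (suc j) in f
    ... | P | P = refl
    ... | P | O = refl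
    ... | Q | Q = refl
    ... | Q | O = refl
    ... | O | _ = refl
    ... | P | Q = ⊥-elim (ℕ.<⇒≢ p+1<q (trans (cong suc (sym (kind-P⁻ e))) (kind-Q⁻ f)))
    ... | Q | P = ⊥-elim (ℕ.<-asym p<q (ℕ.≤-reflexive (trans (cong suc (sym (kind-Q⁻ e))) (kind-P⁻ f))))

    -- Passing to the next row adds a half square at the diagonal; its third edge is a diagonal
    -- edge, and so not a door.
    diagonal : ∀ d → d + p ≤ q → U d (d + p) ≡ false
    diagonal zero _ = refl
    diagonal (suc d) j<q = begin
        U d (suc j) xor W j (suc j) (suc j) (suc j)
      ≡⟨ cong (_xor W j (suc j) (suc j) (suc j))
           (trans (cong (_xor U d (suc j)) (sym (diagonal d j≤q))) (rows d j ℕ.≤-refl j<q)) ⟩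
        W j j j (suc j) xor W j (suc j) (suc j) (suc j)
      ≡⟨ triangle A H C (labels-near A H (ℕ.m≤n⇒m≤1+n (pt-stepʲ j j)))
                  (labels-near H C (ℕ.m≤n⇒m≤1+n (pt-stepⁱ j (suc j))))
                  (labels-near A C (pt-diag j j)) ⟩
        W j j (suc j) (suc j)
      ≡⟨ cong₂ (λ s t → ω (kind s) (kind t)) (lab-diag p≤j j≤q) (lab-diag (ℕ.m≤n⇒m≤1+n p≤j) j<q) ⟩
        ω (kind j) (kind (suc j))
      ≡⟨ consecutive j ⟩
        false ∎
      where
      open ≡-Reasoning
      j = d + p
      p≤j = ℕ.m≤n+m p d
      j≤q = ℕ.<⇒≤ j<q
      A = lab-ok p≤j ℕ.≤-refl j≤q
      C = lab-ok (ℕ.m≤n⇒m≤1+n p≤j) ℕ.≤-refl j<q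
      H = lab-ok p≤j (ℕ.n≤1+n j) j<q

    isQ : Kind → Bool
    isQ Q = true
    isQ _ = false

    -- On the top only the colours `P` and `Q` occur, starting with `P`, so the parity of the doors
    -- passed tells the current colour.
    top-row : ∀ d → d + p ≤ q → U d q ≡ isQ (kind (lab (d + p) q))
    top-row zero _ rewrite lab-side (ℕ.<⇒≤ p<q) ℕ.≤-refl | kind-p = refl
    top-row (suc d) i<q = trans (cong (_xor W (d + p) q (suc d + p) q) (top-row d (ℕ.<⇒≤ i<q)))
        (ends (Label.top (lab-ok p≤i (ℕ.<⇒≤ i<q) ℕ.≤-refl) refl)
              (Label.top (lab-ok (ℕ.m≤n⇒m≤1+n p≤i) i<q ℕ.≤-refl) refl))
      where
      p≤i = ℕ.m≤n+m p d
      ends : ∀ {l l'} → l ≡ p ⊎ l ≡ q → l' ≡ p ⊎ l' ≡ q →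
             isQ (kind l) xor ω (kind l) (kind l') ≡ isQ (kind l')
      ends (inj₁ refl) (inj₁ refl) rewrite kind-p = refl
      ends (inj₁ refl) (inj₂ refl) rewrite kind-p | kind-q = refl
      ends (inj₂ refl) (inj₁ refl) rewrite kind-p | kind-q = refl
      ends (inj₂ refl) (inj₂ refl) rewrite kind-q = refl

    -- The corner with both indices `q` lies on the diagonal and on the top row. The first makes the
    -- parity even; the second, with colour `Q` there, makes it odd.
    impossible : ⊥
    impossible with trans (sym even) odd
      where
      d = q ∸ p
      d+p≡q : d + p ≡ q
      d+p≡q = ℕ.m∸n+n≡m (ℕ.<⇒≤ p<q)
      even : U d q ≡ false
      even = subst (λ t → U d t ≡ false) d+p≡q (diagonal d (ℕ.≤-reflexive d+p≡q))
      odd : U d q ≡ true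
      odd = trans (top-row d (ℕ.≤-reflexive d+p≡q)) (trans (cong (λ t → isQ (kind (lab t q))) d+p≡q)
              (trans (cong (isQ ∘ kind) (lab-diag (ℕ.<⇒≤ p<q) ℕ.≤-refl)) (cong isQ kind-q)))
    ... | ()

  triangulate : Near → ∀ f {p q} → q ≤ f + p → p < q → q ≤ N → D p q ≤ k → Tri k p q
  triangulate near zero q≤p p<q = ⊥-elim (ℕ.<⇒≱ p<q q≤p)
  triangulate near (suc f) {p} {q} q≤ p<q q≤N Dpq with suc p ℕ.≟ q
  ... | yes refl = unit p
  ... | no p+1≢q with ℕ.anyUpTo? (λ y → (p <? y) ×-dec (D p y ≤? k) ×-dec (D y q ≤? k)) q
  ...   | yes (y , y<q , p<y , e , e') = node p<y y<q e e'
            (triangulate near f (ℕ.≤-pred (ℕ.≤-trans y<q q≤)) p<y (ℕ.≤-trans (ℕ.<⇒≤ y<q) q≤N) e)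
            (triangulate near f
              (ℕ.≤-trans q≤ (ℕ.≤-trans (ℕ.≤-reflexive (sym (ℕ.+-suc f p))) (ℕ.+-monoʳ-≤ f p<y))) y<q q≤N e')
  ...   | no none = ⊥-elim (Stuck.impossible near p q (ℕ.≤∧≢⇒< p<q p+1≢q) q≤N Dpq
            (λ y p<y y<q e e' → none (y , y<q , p<y , e , e')))

  decompose : Near → (∀ c → b c < N) → 0 < N → TreeDecomp G (k + k)
  decompose near b<N 0<N = tri⇒decomposition b<N (triangulate near N (ℕ.m≤m+n N 0) 0<N ℕ.≤-refl
    -- The gaps `0` and `N` both lie outside every chord, so the outermost side has length zero.
    (hamming-zero (gap 0) (gap N) (λ c → trans (ins-before {c} z≤n) (sym (ins-after {c} (b<N c))))))

-- Nested covers

∧-true⁺ : ∀ {u v} → u ≡ true → v ≡ true → u ∧ v ≡ true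
∧-true⁺ refl refl = refl

∧-true⁻ : ∀ {u v} → u ∧ v ≡ true → u ≡ true × v ≡ true
∧-true⁻ {true} {true} _ = refl , refl

not-flip : ∀ {u v} → not u ≡ v → u ≡ not v
not-flip {u} refl = sym (Bool.not-involutive u)

true≢false : true ≢ false
true≢false ()

bit-mono : ∀ {u v} → (u ≡ true → v ≡ true) → bit u ≤ bit v
bit-mono {false} f = z≤n
bit-mono {true} f rewrite f refl = ℕ.≤-refl

argmax : ∀ {m} (f : Fin m → Bool) (w : Fin m → ℕ) →
         (∀ i → f i ≡ false) ⊎ ∃ λ i → f i ≡ true × ∀ j → f j ≡ true → w j ≤ w i
argmax {zero} f w = inj₁ λ ()
argmax {suc m} f w with f zero in eq | argmax (f ∘ suc) (w ∘ suc)
... | false | inj₁ none = inj₁ λ { zero → eq ; (suc i) → none i }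
... | true | inj₁ none = inj₂ (zero , eq ,
  λ { zero _ → ℕ.≤-refl ; (suc j) e → ⊥-elim (true≢false (trans (sym e) (none j))) })
... | false | inj₂ (i , fi , best) = inj₂ (suc i , fi ,
  λ { zero e → ⊥-elim (true≢false (trans (sym e) eq)) ; (suc j) e → best j e })
... | true | inj₂ (i , fi , best) with ℕ.≤-total (w zero) (w (suc i))
...   | inj₁ q = inj₂ (suc i , fi , λ { zero _ → q ; (suc j) e → best j e })
...   | inj₂ q = inj₂ (zero , eq , λ { zero _ → ℕ.≤-refl ; (suc j) e → ℕ.≤-trans (best j e) q })

record Nest (G : Graph) (t : ℕ) : Set where
  field
    layer     : Fin t → Fin (n G) → Bool
    nonempty  : ∀ i → ∃ λ c → layer i c ≡ true
    connected : ∀ i → ConnectedIn G (λ c → layer i c ≡ true)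
    disjoint  : ∀ {i j} → i ≢ j → ∀ {c} → layer i c ≡ true → layer j c ≡ true → ⊥
    next      : ∀ {i j} → i F.< j → ∀ {c} → layer i c ≡ true → ∃ λ e → layer j e ≡ true × E G c e

-- Arcs cut off from a median

module Layers {G : Graph} (Δ : Diagram G) (N α β γ : ℕ) (b<N : ∀ c → Diagram.b Δ c < N)
              (α≤N : α < suc N) (β≤N : β < suc N) (γ≤N : γ < suc N) where
  open Gaps Δ

  centre : Fin (n G) → Bool
  centre = median (gap α) (gap β) (gap γ)

  -- s lies on the arc cut off from the centre by the chord c.
  cov : Fin (n G) → ℕ → Bool
  cov c s = centre c xor ins c s

  private
    Miss : Fin (n G) → ℕ → Set
    Miss c s = cov c s ≡ false

    misses-two : ∀ c → (Miss c β × Miss c γ) ⊎ (Miss c α × Miss c γ) ⊎ (Miss c α × Miss c β)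
    misses-two c = table (ins c α) (ins c β) (ins c γ)
      where
      table : ∀ u v w → let m = majority u v w in
              (m xor v ≡ false × m xor w ≡ false) ⊎ (m xor u ≡ false × m xor w ≡ false) ⊎
              (m xor u ≡ false × m xor v ≡ false)
      table true true _ = inj₂ (inj₂ (refl , refl))
      table true false true = inj₂ (inj₁ (refl , refl))
      table true false false = inj₁ (refl , refl)
      table false true true = inj₁ (refl , refl)
      table false true false = inj₂ (inj₁ (refl , refl))
      table false false _ = inj₂ (inj₂ (refl , refl))

  -- Each arc avoids two of the three gaps defining the median, and two such pairs share a gap.
  consistent : ∀ c e → ∃ λ s → cov c s ≡ false × cov e s ≡ false
  consistent c e with misses-two c | misses-two e
  ... | inj₁ (p , _) | inj₁ (q , _) = β , p , q
  ... | inj₁ (_ , p) | inj₂ (inj₁ (_ , q)) = γ , p , q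
  ... | inj₁ (p , _) | inj₂ (inj₂ (_ , q)) = β , p , q
  ... | inj₂ (inj₁ (_ , p)) | inj₁ (_ , q) = γ , p , q
  ... | inj₂ (inj₁ (p , _)) | inj₂ (inj₁ (q , _)) = α , p , q
  ... | inj₂ (inj₁ (p , _)) | inj₂ (inj₂ (q , _)) = α , p , q
  ... | inj₂ (inj₂ (_ , p)) | inj₁ (q , _) = β , p , q
  ... | inj₂ (inj₂ (p , _)) | inj₂ (inj₁ (q , _)) = α , p , q
  ... | inj₂ (inj₂ (p , _)) | inj₂ (inj₂ (q , _)) = α , p , q

  -- Three combinations of sides are prescribed, and the fourth, outside both chords, occurs at gap
  -- `0`; chords for which all four occur must cross.
  quadrants : ∀ {c e u v w} → ins c u ≡ true → ins e u ≡ true → ins c v ≡ true → ins e v ≡ false →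
              ins c w ≡ false → ins e w ≡ true → E G c e
  quadrants {c} {e} {u} {v} {w} cu eu cv ev cw ew
    with ℕ.<-≤-connex (a c) (a e) | ℕ.<-≤-connex (b c) (b e)
       | ins-true⁻ {c} {u} cu | ins-true⁻ {e} {u} eu | ins-true⁻ {c} {v} cv | ins-true⁻ {e} {w} ew
  ... | inj₁ p | inj₁ q | _ , u≤b | a<u , _ | _ | _ = ⇒E (inj₁ (p , ℕ.<-≤-trans a<u u≤b , q))
  ... | inj₁ p | inj₂ q | _ | _ | _ | a<w , w≤b =
    ⊥-elim (true≢false (trans (sym (ins-true {c} {w} (ℕ.<-trans p a<w) (ℕ.≤-trans w≤b q))) cw))
  ... | inj₂ p | inj₁ q | _ | _ | a<v , v≤b | _ =
    ⊥-elim (true≢false (trans (sym (ins-true {e} {v} (ℕ.≤-<-trans p a<v) (ℕ.≤-trans v≤b (ℕ.<⇒≤ q)))) ev))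
  ... | inj₂ p | inj₂ q | a<u , _ | _ , u≤b | _ | _ =
    ⇒E (inj₂ (ℕ.≤∧≢⇒< p ae≢ac , ℕ.<-≤-trans a<u u≤b , ℕ.≤∧≢⇒< q be≢bc))
    where
    differ : c ≢ e
    differ refl = true≢false (trans (sym cv) ev)
    ae≢ac : a e ≢ a c
    ae≢ac eq = differ (sym (a-inj eq))
    be≢bc : b e ≢ b c
    be≢bc eq = differ (sym (b-inj eq))

  -- A gap `z` in neither arc completes the four combinations. Which of `u`, `v`, `w`, `z` lies
  -- inside both chords depends on the sides that the centre takes; hence the four cases.
  overlapping : ∀ {c e u v w} → cov c u ≡ true → cov e u ≡ true → cov c v ≡ true → cov e v ≡ false →
            cov c w ≡ false → cov e w ≡ true → E G c e
  overlapping {c} {e} {u} {v} {w} cu eu cv ev cw ew with consistent c e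
  ... | z , cz , ez with centre c | centre e
  ...   | false | false = quadrants {u = u} {v} {w} cu eu cv ev cw ew
  ...   | true | false = quadrants {u = w} {z} {u} (not-flip cw) ew (not-flip cz) ez (not-flip cu) eu
  ...   | false | true = quadrants {u = v} {u} {z} cv (not-flip ev) cu (not-flip eu) cz (not-flip ez)
  ...   | true | true = quadrants {u = z} {w} {v} (not-flip cz) (not-flip ez)
      (not-flip cw) (not-flip ew) (not-flip cv) (not-flip ev)

  cov-change : ∀ {c e s} → cov c s xor cov c (suc s) ≡ true → cov e s xor cov e (suc s) ≡ true → c ≡ e
  cov-change {c} {e} {s} p q = change-unique {c} {e} {s} (strip (centre c) _ _ p) (strip (centre e) _ _ q)
    where
    strip : ∀ x u v → (x xor u) xor (x xor v) ≡ true → u xor v ≡ true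
    strip false u v e = e
    strip true false true e = refl
    strip true true false e = refl

  cov-no-alternation : ∀ {c β u v w z} → u ≤ v → v ≤ w → w ≤ z → cov c u ≡ β → cov c v ≡ not β →
                       cov c w ≡ β → cov c z ≡ not β → ⊥
  cov-no-alternation {c} {β} uv vw wz p q r s with centre c
  ... | false = no-alternation {c} {β} uv vw wz p q r s
  ... | true = no-alternation {c} {not β} uv vw wz (not-flip p) (not-flip q) (not-flip r) (not-flip s)

  cov-at-a : ∀ c → cov c (a c) xor cov c (suc (a c)) ≡ true
  cov-at-a c rewrite ins-before {c} {a c} ℕ.≤-refl | ins-true {c} {suc (a c)} ℕ.≤-refl (a<b c) with centre c
  ... | true = refl
  ... | false = refl

  a≤N : ∀ c → a c < suc N × suc (a c) < suc N
  a≤N c = s≤s (ℕ.<⇒≤ a<N) , s≤s a<N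
    where
    a<N = ℕ.<-trans (a<b c) (b<N c)

  Family : Set
  Family = Fin (n G) → Bool

  Maximal : Family → Fin (n G) → Set
  Maximal F c = ∀ e → F e ≡ true → (∀ {s} → s < suc N → cov c s ≡ true → cov e s ≡ true) →
                ∀ {s} → s < suc N → cov e s ≡ true → cov c s ≡ true

  Covers : Family → Set
  Covers C = ∀ {s} → s < suc N → ∃ λ c → C c ≡ true × cov c s ≡ true

  -- By maximality, an arc contained in that of `e` would be equal to it. But the arc of `c` changes
  -- at the endpoint `a c`, where no other chord changes.
  sticks-out : ∀ {F c e} → Maximal F c → F e ≡ true → c ≢ e → ∃ λ s → cov c s ≡ true × cov e s ≡ false
  sticks-out {F} {c} {e} max fe c≢e
    with ℕ.anyUpTo? (λ s → (cov c s Bool.≟ true) ×-dec (cov e s Bool.≟ false)) (suc N)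
  ... | yes (s , _ , p , q) = s , p , q
  ... | no none = ⊥-elim (c≢e (cov-change {c} {e} {a c} (cov-at-a c)
          (trans (cong₂ _xor_ (same (proj₁ (a≤N c))) (same (proj₂ (a≤N c)))) (cov-at-a c))))
    where
    c⊆e : ∀ {s} → s < suc N → cov c s ≡ true → cov e s ≡ true
    c⊆e {s} q p with cov e s in eq
    ... | true = refl
    ... | false = ⊥-elim (none (s , q , p , eq))
    e⊆c : ∀ {s} → s < suc N → cov e s ≡ true → cov c s ≡ true
    e⊆c = max e fe c⊆e
    same : ∀ {s} → s < suc N → cov e s ≡ cov c s
    same {s} q with cov c s in p | cov e s in p'
    ... | true | true = refl
    ... | false | false = refl
    ... | true | false = trans (sym p') (c⊆e q p)
    ... | false | true = trans (sym (e⊆c q p')) p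

  module _ {F C : Family} (sub : ∀ {c} → C c ≡ true → F c ≡ true) (max : ∀ {c} → C c ≡ true → Maximal F c) where

    meeting⇒adjacent : ∀ {c e s} → C c ≡ true → C e ≡ true → cov c s ≡ true → cov e s ≡ true → c ≢ e → E G c e
    meeting⇒adjacent {c} {e} {s} pc pe cs es c≢e =
      let v , cv , ev = sticks-out (max pc) (sub pe) c≢e
          w , ew , cw = sticks-out (max pe) (sub pc) (c≢e ∘ sym)
      in overlapping {c} {e} {s} {v} {w} cs es cv ev cw ew

    -- Sweep down to gap `0`, using that two chords over a common gap are equal or cross. Between
    -- the gaps `s + 1` and `s` at most one chord changes, so either `c` itself still covers `s`, or
    -- the chord found over `s` also covers `s + 1` and meets `c` there.
    cover⇒connected : Covers C → (∀ {c} → C c ≡ true → ∃ λ s → s < suc N × cov c s ≡ true) →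
                      ConnectedIn G (λ c → C c ≡ true)
    cover⇒connected covers nonempty u v pu pv = walk-++ (reach pu) (walk-rev (reach pv))
      where
      first = covers {0} (s≤s z≤n)
      c₀ = proj₁ first
      link : ∀ {c e s} → C c ≡ true → C e ≡ true → cov c s ≡ true → cov e s ≡ true → WalkIn G (λ c → C c ≡ true) c e
      link {c} {e} {s} pc pe cs es with c F.≟ e
      ... | yes refl = here pc
      ... | no c≢e = step pc (meeting⇒adjacent {c} {e} {s} pc pe cs es c≢e) (here pe)
      sweep : ∀ s → s < suc N → ∀ {c} → C c ≡ true → cov c s ≡ true → WalkIn G (λ c → C c ≡ true) c c₀
      sweep zero _ pc cs = link {s = 0} pc (proj₁ (proj₂ first)) cs (proj₂ (proj₂ first))
      sweep (suc s) q {c} pc cs with covers {s} (ℕ.<⇒≤ q)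
      ... | e , pe , es with cov e (suc s) in es'
      ...   | true = walk-++ (link {s = suc s} pc pe cs es') (sweep s (ℕ.<⇒≤ q) pe es)
      ...   | false with cov c s in cs'
      ...     | true = sweep s (ℕ.<⇒≤ q) pc cs'
      ...     | false with cov-change {c} {e} {s} (false-xor-true cs' cs) (true-xor-false es es')
      ...       | refl with () ← trans (sym cs) es'
      reach : ∀ {c} → C c ≡ true → WalkIn G (λ c → C c ≡ true) c c₀
      reach pc = let s , q , cs = nonempty pc in sweep s q pc cs

  -- Take the chord `e` of `C'` over the gap just before the endpoint `a c`. Being different from
  -- `c`, it covers the gap just after as well, and exactly one of the two lies on the arc of `c`.
  -- This gives a common gap and one outside `c`; maximality gives one outside `e`.
  maximal⇒adjacent : ∀ {F C' c} → Maximal F c → F c ≡ true → C' c ≡ false → (∀ {e} → C' e ≡ true → F e ≡ true) →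
                     Covers C' → ∃ λ e → C' e ≡ true × E G c e
  maximal⇒adjacent {F} {C'} {c} max fc c∉ sub covers = e , pe , adjacent
    where
    found = covers (proj₁ (a≤N c))
    e = proj₁ found
    pe = proj₁ (proj₂ found)
    c≢e : c ≢ e
    c≢e eq = true≢false (trans (sym (subst (λ d → C' d ≡ true) (sym eq) pe)) c∉)
    at-a : cov e (a c) ≡ true
    at-a = proj₂ (proj₂ found)
    after-a : cov e (suc (a c)) ≡ true
    after-a with cov e (suc (a c)) in eq
    ... | true = refl
    ... | false = ⊥-elim (c≢e (cov-change {c} {e} {a c} (cov-at-a c) (true-xor-false at-a eq)))
    adjacent : E G c e
    adjacent with sticks-out max (sub pe) c≢e | cov c (a c) in p | cov c (suc (a c)) in q
    ... | v , cv , ev | true | false = overlapping {c} {e} {a c} {v} {suc (a c)} p at-a cv ev q after-a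
    ... | v , cv , ev | false | true = overlapping {c} {e} {suc (a c)} {v} {a c} q after-a cv ev p at-a
    ... | _ | true | true with () ← trans (sym (cov-at-a c)) (cong₂ _xor_ p q)
    ... | _ | false | false with () ← trans (sym (cov-at-a c)) (cong₂ _xor_ p q)

  Private : Family → Set
  Private C = ∀ {c} → C c ≡ true → ∃ λ s → s < suc N × cov c s ≡ true × ∀ {e} → C e ≡ true → cov e s ≡ true → e ≡ c

  covered? : ∀ (C : Family) s → Dec (∃ λ c → C c ≡ true × cov c s ≡ true)
  covered? C s = F.any? (λ c → (C c Bool.≟ true) ×-dec (cov c s Bool.≟ true))

  minimise : ∀ k (C : Family) → count C ≤ k → Covers C →
             ∃ λ C' → (∀ {c} → C' c ≡ true → C c ≡ true) × Covers C' × Private C'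
  minimise k C size covers
    with F.any? (λ c → (C c Bool.≟ true) ×-dec ℕ.allUpTo? (covered? (C ∖ c)) (suc N))
  minimise zero C size covers | yes (c , pc , _) = ⊥-elim (ℕ.<⇒≱ (s≤s z≤n) (ℕ.≤-trans (count-remove C c pc) size))
  minimise (suc k) C size covers | yes (c , pc , covers')
    with minimise k (C ∖ c) (ℕ.≤-pred (ℕ.≤-trans (count-remove C c pc) size)) covers'
  ... | C' , sub , rest = C' , (λ {d} p → proj₁ (∖-true⁻ {f = C} {c} {d} (sub p))) , rest
  minimise k C size covers | no irredundant = C , (λ p → p) , covers , own
    where
    own : Private C
    own {c} pc with ℕ.anyUpTo? (λ s → ¬? (covered? (C ∖ c) s)) (suc N)
    ... | no none = ⊥-elim (irredundant (c , pc ,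
      λ {s} q → decidable-stable (covered? (C ∖ c) s) (λ ¬p → none (s , q , ¬p))))
    ... | yes (s , q , lone) = s , q , c-covers , only
      where
      only : ∀ {e} → C e ≡ true → cov e s ≡ true → e ≡ c
      only {e} pe es with e F.≟ c
      ... | yes eq = eq
      ... | no e≢c = ⊥-elim (lone (e , ∖-true⁺ {f = C} {c} {e} pe e≢c , es))
      c-covers : cov c s ≡ true
      c-covers = let e , pe , es = covers q in subst (λ e → cov e s ≡ true) (only pe es) es

  module _ {C : Family} (own : Private C) where

    located : ∀ c → ∃ λ s → C c ≡ true → cov c s ≡ true × ∀ {e} → C e ≡ true → cov e s ≡ true → e ≡ c
    located c with C c Bool.≟ true
    ... | yes pc = let s , _ , cs , only = own pc in s , λ _ → cs , only
    -- A dummy value; homes matter only for members of `C`.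
    ... | no ¬pc = 0 , ⊥-elim ∘ ¬pc

    home : Fin (n G) → ℕ
    home c = proj₁ (located c)

    home-self : ∀ {c} → C c ≡ true → cov c (home c) ≡ true
    home-self {c} pc = proj₁ (proj₂ (located c) pc)

    home-other : ∀ {c e} → C c ≡ true → C e ≡ true → e ≢ c → cov e (home c) ≡ false
    home-other {c} {e} pc pe e≢c with cov e (home c) in eq
    ... | false = refl
    ... | true = ⊥-elim (e≢c (proj₂ (proj₂ (located c) pc) pe eq))

    module _ (s : ℕ) where

      Here : Fin (n G) → Set
      Here c = C c ≡ true × cov c s ≡ true

      -- Three arcs through s with homes on one side of s: the middle one contains s and its own home,
      -- but not the homes on either side of its own.
      after-three : ∀ {c d e} → Here c → Here d → Here e → d ≢ c → d ≢ e → s ≤ home c →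
                    home c ≤ home d → home d ≤ home e → ⊥
      after-three {c} {d} {e} (pc , _) (pd , ds) (pe , _) d≢c d≢e p q r =
        cov-no-alternation {d} {true} p q r ds (home-other pc pd d≢c) (home-self pd) (home-other pe pd d≢e)

      before-three : ∀ {c d e} → Here c → Here d → Here e → d ≢ c → d ≢ e → home e ≤ s →
                     home c ≤ home d → home d ≤ home e → ⊥
      before-three {c} {d} {e} (pc , _) (pd , ds) (pe , _) d≢c d≢e p q r =
        cov-no-alternation {d} {false} q r p (home-other pc pd d≢c) (home-self pd) (home-other pe pd d≢e) ds

      sorted : ∀ {P : Fin (n G) → Set} →
               (∀ {c d e} → P c → P d → P e → d ≢ c → d ≢ e → home c ≤ home d → home d ≤ home e → ⊥) →
               ∀ {c d e} → P c → P d → P e → c ≢ d → d ≢ e → c ≢ e → ⊥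
      sorted bad {c} {d} {e} pc pd pe cd de ce
        with ℕ.≤-total (home c) (home d) | ℕ.≤-total (home d) (home e) | ℕ.≤-total (home c) (home e)
      ... | inj₁ p | inj₁ q | _ = bad pc pd pe (cd ∘ sym) de p q
      ... | inj₁ p | inj₂ q | inj₁ r = bad pc pe pd (ce ∘ sym) (de ∘ sym) r q
      ... | inj₁ p | inj₂ q | inj₂ r = bad pe pc pd ce cd r p
      ... | inj₂ p | inj₁ q | inj₁ r = bad pd pc pe cd ce p r
      ... | inj₂ p | inj₁ q | inj₂ r = bad pd pe pc (de ∘ sym) (ce ∘ sym) q r
      ... | inj₂ p | inj₂ q | _ = bad pe pd pc de (cd ∘ sym) q p

      at-most-two : ∀ (f : Fin (n G) → Bool) →
                    (∀ {c d e} → f c ≡ true → f d ≡ true → f e ≡ true → c ≢ d → d ≢ e → c ≢ e → ⊥) → count f ≤ 2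
      at-most-two f no-three with count f ≤? 2
      ... | yes q = q
      ... | no ¬q with count-extract f (ℕ.≰⇒> ¬q)
      ...   | c , fc , q with count-extract (f ∖ c) q
      ...     | d , fd , q' with count-extract ((f ∖ c) ∖ d) q'
      ...       | e , fe , _ with ∖-true⁻ {f = f} {c} {d} fd | ∖-true⁻ {f = f ∖ c} {d} {e} fe
      ...         | fd' , d≢c | fe' , e≢d with ∖-true⁻ {f = f} {c} {e} fe'
      ...           | fe'' , e≢c = ⊥-elim (no-three fc fd' fe'' (d≢c ∘ sym) (e≢d ∘ sym) (e≢c ∘ sym))

      -- Among the chords over `s`, at most two have their home at or before `s` and at most two at
      -- or after it.
      thin : count (λ c → C c ∧ cov c s) ≤ 4
      thin = ℕ.≤-trans (count-subadditive _ before after split)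
               (ℕ.+-mono-≤ (at-most-two before no-before) (at-most-two after no-after))
        where
        before after : Fin (n G) → Bool
        before c = (C c ∧ cov c s) ∧ does (home c ≤? s)
        after c = (C c ∧ cov c s) ∧ does (s ≤? home c)
        split : ∀ c → bit (C c ∧ cov c s) ≤ bit (before c) + bit (after c)
        split c with C c ∧ cov c s | ℕ.≤-total (home c) s
        ... | false | _ = z≤n
        ... | true | inj₁ q rewrite dec-true (home c ≤? s) q = s≤s z≤n
        ... | true | inj₂ q rewrite dec-true (s ≤? home c) q = ℕ.m≤n+m 1 _
        before⁻ : ∀ {c} → before c ≡ true → Here c × home c ≤ s
        before⁻ {c} e = let p , q = ∧-true⁻ {C c ∧ cov c s} e in ∧-true⁻ {C c} p , does-true⁻ (home c ≤? s) q
        after⁻ : ∀ {c} → after c ≡ true → Here c × s ≤ home c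
        after⁻ {c} e = let p , q = ∧-true⁻ {C c ∧ cov c s} e in ∧-true⁻ {C c} p , does-true⁻ (s ≤? home c) q
        no-before : ∀ {c d e} → before c ≡ true → before d ≡ true → before e ≡ true → c ≢ d → d ≢ e → c ≢ e → ⊥
        no-before p q r = sorted {λ c → Here c × home c ≤ s}
          (λ (p , _) (q , _) (r , l) d≢c d≢e → before-three p q r d≢c d≢e l) (before⁻ p) (before⁻ q) (before⁻ r)
        no-after : ∀ {c d e} → after c ≡ true → after d ≡ true → after e ≡ true → c ≢ d → d ≢ e → c ≢ e → ⊥
        no-after p q r = sorted {λ c → Here c × s ≤ home c}
          (λ (p , l) (q , _) (r , _) d≢c d≢e → after-three p q r d≢c d≢e l) (after⁻ p) (after⁻ q) (after⁻ r)

  arc-size : Fin (n G) → ℕ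
  arc-size c = count {suc N} (λ s → cov c (toℕ s))

  arc-size-mono : ∀ {c e s} → (∀ {s} → s < suc N → cov c s ≡ true → cov e s ≡ true) → s < suc N →
                  cov e s ≡ true → cov c s ≡ false → arc-size c < arc-size e
  arc-size-mono {c} {e} {s} c⊆e q es cs = ℕ.≤-trans (s≤s (count-mono _ _ below))
      (count-remove (λ s → cov e (toℕ s)) i (trans (cong (cov e) (F.toℕ-fromℕ< q)) es))
    where
    i = fromℕ< q
    below : ∀ j → bit (cov c (toℕ j)) ≤ bit (((λ s → cov e (toℕ s)) ∖ i) j)
    below j = bit-mono λ cj → ∖-true⁺ {f = λ s → cov e (toℕ s)} {i} {j} (c⊆e (F.toℕ<n j) cj)
      λ { refl → true≢false (trans (sym cj) (trans (cong (cov c) (F.toℕ-fromℕ< q)) cs)) }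

  -- For each gap choose an arc with the most gaps among those of `F` covering it. A properly larger
  -- arc would cover the same gap and have more gaps, so the choice is inclusion-maximal.
  maximal-cover : ∀ {F} → Covers F → ∃ λ C → (∀ {c} → C c ≡ true → F c ≡ true × Maximal F c) × Covers C
  maximal-cover {F} covers = C , inside , λ {s} q → let i = fromℕ< q in
      proj₁ (best i) , dec-true (F.any? (λ i → proj₁ (best i) F.≟ proj₁ (best (fromℕ< q)))) (i , refl)
      , trans (cong (cov (proj₁ (best i))) (sym (F.toℕ-fromℕ< q))) (proj₁ (proj₂ (proj₂ (best i))))
    where
    best : ∀ (i : Fin (suc N)) → ∃ λ c → F c ≡ true × cov c (toℕ i) ≡ true × Maximal F c
    best i with argmax (λ c → F c ∧ cov c (toℕ i)) arc-size
    ... | inj₁ none = let c , p , q = covers (F.toℕ<n i) in ⊥-elim (true≢false (trans (sym (∧-true⁺ p q)) (none c)))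
    ... | inj₂ (c , p , most) = c , proj₁ (∧-true⁻ {F c} p) , ci , max
      where
      ci = proj₂ (∧-true⁻ {F c} p)
      max : Maximal F c
      max e fe c⊆e {s} q es with cov c s in cs
      ... | true = refl
      ... | false = ⊥-elim (ℕ.<⇒≱ (arc-size-mono {c} {e} c⊆e q es cs) (most e (∧-true⁺ fe (c⊆e (F.toℕ<n i) ci))))
    C : Family
    C c = does (F.any? (λ i → proj₁ (best i) F.≟ c))
    inside : ∀ {c} → C c ≡ true → F c ≡ true × Maximal F c
    inside {c} p with does-true⁻ (F.any? (λ i → proj₁ (best i) F.≟ c)) p
    ... | i , refl = proj₁ (proj₂ (best i)) , proj₂ (proj₂ (proj₂ (best i)))

  record Layer (F : Family) : Set where
    field
      C         : Family
      C⊆F       : ∀ {c} → C c ≡ true → F c ≡ true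
      C-max     : ∀ {c} → C c ≡ true → Maximal F c
      C-covers  : Covers C
      C-conn    : ConnectedIn G (λ c → C c ≡ true)
      C-thin    : ∀ s → count (λ c → C c ∧ cov c s) ≤ 4

  -- Maximal arcs are selected first and redundant ones discarded afterwards: maximality refers to
  -- `F`, so it survives the second step.
  innermost : ∀ {F} → Covers F → Layer F
  innermost {F} F-covers with maximal-cover F-covers
  ... | C₀ , max , covers₀ with minimise _ C₀ ℕ.≤-refl covers₀
  ...   | C , sub , covers , own = record
    { C = C
    ; C⊆F = λ p → proj₁ (max (sub p))
    ; C-max = λ p → proj₂ (max (sub p))
    ; C-covers = covers
    ; C-conn = cover⇒connected {F} {C} (λ p → proj₁ (max (sub p))) (λ p → proj₂ (max (sub p))) covers
                 (λ p → let s , q , cs , _ = own p in s , q , cs)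
    ; C-thin = thin {C} own
    }

  record Within (F : Family) (t : ℕ) : Set where
    field
      nest    : Nest G t
      inside  : ∀ i {c} → Nest.layer nest i c ≡ true → F c ≡ true
      covers  : ∀ i → Covers (Nest.layer nest i)

  remove : Family → Family → Family
  remove F C c = F c ∧ not (C c)

  remove⁻ : ∀ {F C c} → remove F C c ≡ true → F c ≡ true × C c ≡ false
  remove⁻ {F} {C} {c} p with F c | C c
  ... | true | false = refl , refl

  extend : ∀ {t F} (L : Layer F) → Within (remove F (Layer.C L)) t → Within F (suc t)
  extend {t} {F} L W = record
    { nest = record { layer = layer ; nonempty = nonempty ; connected = connected ; disjoint = disjoint ; next = next }
    ; inside = inside ; covers = covers }
    where
    open Layer L
    module W = Within W
    module N = Nest W.nest
    layer : Fin (suc t) → Family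
    layer zero = C
    layer (suc i) = N.layer i
    covers : ∀ i → Covers (layer i)
    covers zero = C-covers
    covers (suc i) = W.covers i
    inside : ∀ i {c} → layer i c ≡ true → F c ≡ true
    inside zero p = C⊆F p
    inside (suc i) {c} p = proj₁ (remove⁻ {F} {C} {c} (W.inside i p))
    nonempty : ∀ i → ∃ λ c → layer i c ≡ true
    nonempty i = let c , p , _ = covers i {0} (s≤s z≤n) in c , p
    connected : ∀ i → ConnectedIn G (λ c → layer i c ≡ true)
    connected zero = C-conn
    connected (suc i) = N.connected i
    outside : ∀ i {c} → C c ≡ true → N.layer i c ≡ true → ⊥
    outside i {c} p q = true≢false (trans (sym p) (proj₂ (remove⁻ {F} {C} {c} (W.inside i q))))
    disjoint : ∀ {i j} → i ≢ j → ∀ {c} → layer i c ≡ true → layer j c ≡ true → ⊥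
    disjoint {zero} {zero} i≢j _ _ = i≢j refl
    disjoint {zero} {suc j} _ p q = outside j p q
    disjoint {suc i} {zero} _ p q = outside i q p
    disjoint {suc i} {suc j} i≢j p q = N.disjoint (i≢j ∘ cong suc) p q
    next : ∀ {i j} → i F.< j → ∀ {c} → layer i c ≡ true → ∃ λ e → layer j e ≡ true × E G c e
    next {zero} {suc j} _ {c} p =
      maximal⇒adjacent {F} {N.layer j} {c} (C-max p) (C⊆F p) c∉ (inside (suc j)) (W.covers j)
      where
      c∉ : N.layer j c ≡ false
      c∉ with N.layer j c in eq
      ... | false = refl
      ... | true = ⊥-elim (outside j p eq)
    next {suc i} {suc j} (s≤s i<j) p = N.next i<j p

  Deep : ℕ → Family → Set
  Deep k F = ∀ {s} → s < suc N → k ≤ count (λ c → F c ∧ cov c s)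

  deep⇒covers : ∀ {k F} → Deep (suc k) F → Covers F
  deep⇒covers {F = F} deep {s} q with count-extract (λ c → F c ∧ cov c s) (ℕ.≤-trans (s≤s z≤n) (deep q))
  ... | c , p , _ = c , ∧-true⁻ {F c} p

  -- A layer uses at most four chords over each gap; this is the factor 4 in `peel`.
  remaining : ∀ {k F} (L : Layer F) → Deep (4 + k) F → Deep k (remove F (Layer.C L))
  remaining {k} {F} L deep {s} q = ℕ.+-cancelˡ-≤ 4 _ _ (ℕ.≤-trans (deep q) (ℕ.≤-trans
    (count-subadditive (λ c → F c ∧ cov c s) (λ c → C c ∧ cov c s) (λ c → remove F C c ∧ cov c s)
      (λ c → split (F c) (C c) (cov c s)))
    (ℕ.+-monoˡ-≤ _ (C-thin s))))
    where
    open Layer L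
    split : ∀ f c v → bit (f ∧ v) ≤ bit (c ∧ v) + bit ((f ∧ not c) ∧ v)
    split false c v = z≤n
    split true true v = ℕ.m≤m+n _ _
    split true false v = ℕ.≤-refl

  peel : ∀ t F → Deep (t * 4) F → Within F t
  peel zero F _ = record
    { nest = record { layer = λ () ; nonempty = λ () ; connected = λ () ; disjoint = λ { {()} } ; next = λ { {()} } }
    ; inside = λ () ; covers = λ () }
  peel (suc t) F deep = extend L (peel t _ (remaining L deep))
    where
    L = innermost (deep⇒covers {F = F} deep)

-- Upper bounds on the treewidth

bounded : ∀ {m} (f : Fin m → ℕ) → ∃ λ M → ∀ i → f i < M
bounded {zero} f = 0 , λ ()
bounded {suc m} f with bounded (f ∘ suc)
... | M , f<M = suc (f zero) + M , λ
  { zero → ℕ.m≤m+n (suc (f zero)) M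
  ; (suc i) → ℕ.<-≤-trans (f<M i) (ℕ.m≤n+m M (suc (f zero))) }

module _ {W : ℕ} where

  lex-< : ∀ {q q' r r'} → q < q' → r < W → q * W + r < q' * W + r'
  lex-< {q} {q'} {r} {r'} q<q' r<W = begin-strict
    q * W + r    <⟨ ℕ.+-monoʳ-< (q * W) r<W ⟩
    q * W + W    ≡⟨ ℕ.+-comm (q * W) W ⟩
    suc q * W    ≤⟨ ℕ.*-monoˡ-≤ W q<q' ⟩
    q' * W       ≤⟨ ℕ.m≤m+n (q' * W) r' ⟩
    q' * W + r'  ∎
    where open ℕ.≤-Reasoning

  lex-<⁻ : ∀ {q q' r r'} → r' < W → q * W + r < q' * W + r' → q < q' ⊎ (q ≡ q' × r < r')
  lex-<⁻ {q} {q'} {r} {r'} r'<W lt with ℕ.<-cmp q q'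
  ... | tri< q<q' _ _ = inj₁ q<q'
  ... | tri≈ _ refl _ = inj₂ (refl , ℕ.+-cancelˡ-< (q * W) r r' lt)
  ... | tri> _ _ q'<q = ⊥-elim (ℕ.<-asym lt (lex-< q'<q r'<W))

  lex-≡⁻ : ∀ {q q' r r'} → r < W → r' < W → q * W + r ≡ q' * W + r' → q ≡ q' × r ≡ r'
  lex-≡⁻ {q} {q'} {r} {r'} r<W r'<W eq with ℕ.<-cmp q q'
  ... | tri< q<q' _ _ = ⊥-elim (ℕ.<⇒≢ (lex-< q<q' r<W) eq)
  ... | tri≈ _ refl _ = refl , ℕ.+-cancelˡ-≡ (q * W) r r' eq
  ... | tri> _ _ q'<q = ⊥-elim (ℕ.<⇒≢ (lex-< q'<q r'<W) (sym eq))

-- At a common endpoint, first the chords ending there (innermost first), then the chords starting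
-- there (outermost first): pulled apart in this order, chords sharing an endpoint do not cross.
module Perturbation {m : ℕ} (C : ChordFamily m) (M : ℕ) (b<M : ∀ i → ChordFamily.b C i < M) where
  open ChordFamily C

  W : ℕ
  W = M + M

  a⁺ b⁺ : Fin m → ℕ
  a⁺ i = a i * W + (M + (M ∸ b i))
  b⁺ i = b i * W + (M ∸ a i)

  private
    a<M : ∀ i → a i < M
    a<M i = ℕ.<-trans (a<b i) (b<M i)

    a-res : ∀ i → M + (M ∸ b i) < W
    a-res i = ℕ.+-monoʳ-< M (ℕ.∸-monoʳ-< (ℕ.≤-<-trans z≤n (a<b i)) (ℕ.<⇒≤ (b<M i)))

    b-res≤ : ∀ i → M ∸ a i ≤ M
    b-res≤ i = ℕ.m∸n≤m M (a i)

    b-res : ∀ i → M ∸ a i < W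
    b-res i = ℕ.≤-<-trans (b-res≤ i) (ℕ.<-≤-trans (ℕ.m<m+n M (ℕ.≤-<-trans z≤n (b<M i))) ℕ.≤-refl)

    b-res<a-res : ∀ i j → M ∸ a i < M + (M ∸ b j)
    b-res<a-res i j = ℕ.≤-<-trans (b-res≤ i) (ℕ.m<m+n M (ℕ.m<n⇒0<n∸m (b<M j)))

    ∸-flip : ∀ {u v} → M ∸ u < M ∸ v → v < u
    ∸-flip {u} {v} lt = ℕ.≰⇒> (λ u≤v → ℕ.<⇒≱ lt (ℕ.∸-monoʳ-≤ M u≤v))

    ∸-inj : ∀ {u v} → u < M → v < M → M ∸ u ≡ M ∸ v → u ≡ v
    ∸-inj p q = ℕ.∸-cancelˡ-≡ (ℕ.<⇒≤ p) (ℕ.<⇒≤ q)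

  a⁺<b⁺ : ∀ i → a⁺ i < b⁺ i
  a⁺<b⁺ i = lex-< (a<b i) (a-res i)

  a⁺-inj : ∀ {i j} → a⁺ i ≡ a⁺ j → i ≡ j
  a⁺-inj {i} {j} eq with lex-≡⁻ {q = a i} {a j} (a-res i) (a-res j) eq
  ... | p , q = distinct i j p (∸-inj (b<M i) (b<M j) (ℕ.+-cancelˡ-≡ M _ _ q))

  b⁺-inj : ∀ {i j} → b⁺ i ≡ b⁺ j → i ≡ j
  b⁺-inj {i} {j} eq with lex-≡⁻ {q = b i} {b j} (b-res i) (b-res j) eq
  ... | p , q = distinct i j (∸-inj (a<M i) (a<M j) q) p

  a⁺≢b⁺ : ∀ {i j} → a⁺ i ≢ b⁺ j
  a⁺≢b⁺ {i} {j} eq = ℕ.<⇒≢ (b-res<a-res j i) (sym (proj₂ (lex-≡⁻ {q = a i} {b j} (a-res i) (b-res j) eq)))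

  private
    interleave : ∀ {i j} → a i < a j → a j < b i → b i < b j → a⁺ i < a⁺ j × a⁺ j < b⁺ i × b⁺ i < b⁺ j
    interleave {i} {j} p q r = lex-< p (a-res i) , lex-< q (a-res j) , lex-< r (b-res i)

    -- Only ties in the leading digit need care. At a common place no left end precedes a right end,
    -- and a tie between two left or two right ends orders the chords as nested, against the
    -- inequality at their other ends.
    interleave⁻ : ∀ {i j} → a⁺ i < a⁺ j → a⁺ j < b⁺ i → b⁺ i < b⁺ j → a i < a j × a j < b i × b i < b j
    interleave⁻ {i} {j} p q r
      with lex-<⁻ {q = a i} {a j} (a-res j) p | lex-<⁻ {q = a j} {b i} (b-res i) q | lex-<⁻ {q = b i} {b j} (b-res j) r
    ... | _ | inj₂ (_ , lt) | _ = ⊥-elim (ℕ.<-asym lt (b-res<a-res i j))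
    ... | inj₁ p' | inj₁ q' | inj₁ r' = p' , q' , r'
    ... | inj₁ p' | inj₁ q' | inj₂ (_ , lt) = ⊥-elim (ℕ.<-asym p' (∸-flip lt))
    ... | inj₂ (_ , lt) | _ | inj₁ r' = ⊥-elim (ℕ.<-asym r' (∸-flip (ℕ.+-cancelˡ-< M _ _ lt)))
    ... | inj₂ (e , _) | _ | inj₂ (_ , lt) = ⊥-elim (ℕ.<⇒≢ (∸-flip lt) (sym e))

  crosses⁺ : ∀ {i j} → Crosses (a i) (b i) (a j) (b j) → Crosses (a⁺ i) (b⁺ i) (a⁺ j) (b⁺ j)
  crosses⁺ {i} {j} (inj₁ (p , q , r)) = inj₁ (interleave {i} {j} p q r)
  crosses⁺ {i} {j} (inj₂ (p , q , r)) = inj₂ (interleave {j} {i} p q r)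

  crosses⁻ : ∀ {i j} → Crosses (a⁺ i) (b⁺ i) (a⁺ j) (b⁺ j) → Crosses (a i) (b i) (a j) (b j)
  crosses⁻ {i} {j} (inj₁ (p , q , r)) = inj₁ (interleave⁻ {i} {j} p q r)
  crosses⁻ {i} {j} (inj₂ (p , q , r)) = inj₂ (interleave⁻ {j} {i} p q r)

circle⇒diagram : ∀ {G} → IsCircleGraph G → Diagram G
circle⇒diagram {G} (m , C , iso) = record
  { a = a⁺ ∘ to
  ; b = b⁺ ∘ to
  ; a<b = a⁺<b⁺ ∘ to
  ; a-inj = to-inj ∘ a⁺-inj
  ; b-inj = to-inj ∘ b⁺-inj
  ; a≢b = a⁺≢b⁺
  ; E⇒ = λ {c} {d} e → crosses⁺ (pres c d e)
  ; ⇒E = λ {c} {d} x → reflect c d (crosses⁻ x)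
  }
  where
  open _≅_ iso
  open Perturbation C (proj₁ (bounded (ChordFamily.b C))) (proj₂ (bounded (ChordFamily.b C)))
  to-inj : ∀ {u v} → to u ≡ to v → u ≡ v
  to-inj {u} {v} e = trans (sym (from-to u)) (trans (cong from e) (from-to v))

-- With `r` equal to 4t, `k` is 16t + 4 and the width `k + k` is 32t + 8. Otherwise some median has
-- more than 4t chords between it and every gap, enough for `t` layers. A finite search through the
-- triples of gaps decides between the two.
decomposition-or-nest : ∀ {G} → IsCircleGraph G → ∀ t → TreeDecomp G (32 * t + 8) ⊎ Nest G t
decomposition-or-nest {G} circle t = choose (ℕ.anyUpTo? (λ α → ℕ.anyUpTo? (λ β → ℕ.anyUpTo? (λ γ →
    ℕ.allUpTo? (λ s → t * 4 <? distance α β γ s) (suc N)) (suc N)) (suc N)) (suc N))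
  where
  Δ : Diagram G
  Δ = circle⇒diagram circle
  open Gaps Δ using (b; gap)
  N : ℕ
  -- The successor keeps `N` positive even when there are no chords.
  N = suc (proj₁ (bounded b))
  b<N : ∀ c → b c < N
  b<N c = ℕ.m<n⇒m<1+n (proj₂ (bounded b) c)
  open Triangulation Δ N (t * 4) using (Near; decompose)
  distance : ℕ → ℕ → ℕ → ℕ → ℕ
  distance α β γ s = hamming (median (gap α) (gap β) (gap γ)) (gap s)
  Far : Set
  Far = ∃ λ α → α < suc N × ∃ λ β → β < suc N × ∃ λ γ → γ < suc N × ∀ {s} → s < suc N → t * 4 < distance α β γ s
  ¬far⇒near : ¬ Far → Near
  ¬far⇒near none {α} {β} {γ} α≤N β≤N γ≤N with ℕ.anyUpTo? (λ s → distance α β γ s ≤? t * 4) (suc N)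
  ... | yes found = found
  ... | no ¬found = ⊥-elim (none (α , α≤N , β , β≤N , γ , γ≤N ,
                      λ {s} s≤N → ℕ.≰⇒> (λ close → ¬found (s , s≤N , close))))
  width : ∀ t → let h = 2 + (t * 4 + t * 4) in (h + h) + (h + h) ≡ 32 * t + 8
  width = solve 1 (λ t → let h = con 2 :+ (t :* con 4 :+ t :* con 4) in
                         (h :+ h) :+ (h :+ h) := con 32 :* t :+ con 8) refl
    where open +-*-Solver
  choose : Dec Far → TreeDecomp G (32 * t + 8) ⊎ Nest G t
  choose (yes (α , α≤N , β , β≤N , γ , γ≤N , far)) =
    -- For the family of all chords, the number of arcs over a gap is by definition the distance of
    -- that gap from the median.
    inj₂ (Layers.Within.nest (peel t (λ _ → true) (λ q → ℕ.<⇒≤ (far q))))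
    where open Layers Δ N α β γ b<N α≤N β≤N γ≤N using (peel)
  choose (no none) = inj₁ (subst (TreeDecomp G) (width t) (decompose (¬far⇒near none) b<N (s≤s z≤n)))

nest⇒minor : ∀ {G t} → Nest G t → KMinor G t
nest⇒minor {G} {t} S = record
  { branch = λ i → tabulate (layer i)
  ; nonempty = λ i → let c , p = nonempty i in c , ∈-tabulate⁺ (layer i) p
  ; connected = λ i u v p q → walk-map (λ _ → ∈-tabulate⁺ (layer i))
                  (connected i u v (∈-tabulate⁻ (layer i) p) (∈-tabulate⁻ (layer i) q))
  ; disjoint = λ i j i≢j v p q → disjoint i≢j (∈-tabulate⁻ (layer i) p) (∈-tabulate⁻ (layer j) q)
  ; adjacent = adjacent
  }
  where
  open Nest S
  edge : ∀ {i j} → i F.< j → ∃₂ λ u v → (u ∈ tabulate (layer i)) × (v ∈ tabulate (layer j)) × E G u v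
  edge {i} {j} i<j = let u , p = nonempty i ; v , q , e = next i<j p
                     in u , v , ∈-tabulate⁺ (layer i) p , ∈-tabulate⁺ (layer j) q , e
  adjacent : ∀ i j → i ≢ j → ∃₂ λ u v → (u ∈ tabulate (layer i)) × (v ∈ tabulate (layer j)) × E G u v
  adjacent i j i≢j with F.<-cmp i j
  ... | tri< i<j _ _ = edge i<j
  ... | tri≈ _ e _ = ⊥-elim (i≢j e)
  ... | tri> _ _ j<i = let u , v , p , q , e = edge j<i in v , u , q , p , E-sym G e

linked-snoc : ∀ {G : Graph} {x u v y l} → E G x u → Path {G} u v l → E G v y → Linked (E G) (x ∷ l ++ y ∷ [])
linked-snoc e [ _ ] f = e ∷ f ∷ [-]
linked-snoc e (e' ∷ p) f = e ∷ linked-snoc e' p f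

-- One branch vertex in each of the first s layers; each pair is joined inside a layer of its own.
nest⇒top-minor : ∀ {G} s → Nest G (s + s * s) → TopKMinor G s
nest⇒top-minor {G} s S = record
  { bv = bv
  ; bv-inj = bv-inj
  ; inner = λ i j → proj₁ (route i j)
  ; path = λ i j _ → proj₁ (proj₂ (route i j))
  ; uniq = λ i j _ → proj₁ (proj₂ (proj₂ (route i j)))
  ; avoid = λ { i j _ k v v∈ refl → disjoint (hub≢pair k i j) (bv∈ k) (within i j v∈) }
  ; disjoint = λ i j i' j' _ _ ne v v∈ v∈' → disjoint (pair≢ ne) (within i j v∈) (within i' j' v∈')
  }
  where
  open Nest S
  hub : Fin s → Fin (s + s * s)
  hub i = i ↑ˡ (s * s)
  pair : Fin s → Fin s → Fin (s + s * s)
  pair i j = s ↑ʳ F.combine i j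
  bv : Fin s → Fin (n G)
  bv i = proj₁ (nonempty (hub i))
  bv∈ : ∀ i → layer (hub i) (bv i) ≡ true
  bv∈ i = proj₂ (nonempty (hub i))
  hub<pair : ∀ k i j → hub k F.< pair i j
  hub<pair k i j rewrite F.toℕ-↑ˡ k (s * s) | F.toℕ-↑ʳ s (F.combine i j) = ℕ.<-≤-trans (F.toℕ<n k) (ℕ.m≤m+n s _)
  hub≢pair : ∀ k i j → hub k ≢ pair i j
  hub≢pair k i j e = ℕ.<⇒≢ (hub<pair k i j) (cong toℕ e)
  pair≢ : ∀ {i j i' j'} → i ≢ i' ⊎ j ≢ j' → pair i j ≢ pair i' j'
  pair≢ {i} {j} {i'} {j'} ne e with F.combine-injective i j i' j' (F.↑ʳ-injective s _ _ e)
  pair≢ (inj₁ ne) e | p , q = ne p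
  pair≢ (inj₂ ne) e | p , q = ne q
  bv-inj : ∀ i j → bv i ≡ bv j → i ≡ j
  bv-inj i j e with i F.≟ j
  ... | yes p = p
  ... | no i≢j = ⊥-elim (disjoint (λ h → i≢j (F.↑ˡ-injective (s * s) i j h)) (bv∈ i)
                   (subst (λ v → layer (hub j) v ≡ true) (sym e) (bv∈ j)))
  route : ∀ i j → ∃ λ l → Linked (E G) (bv i ∷ l ++ bv j ∷ []) × Unique l × All.All (λ c → layer (pair i j) c ≡ true) l
  route i j with next (hub<pair i i j) (bv∈ i) | next (hub<pair j i j) (bv∈ j)
  ... | u , pu , eu | v , pv , ev with loop-erase (connected (pair i j) u v pu pv)
  ...   | l , p , un , al = l , linked-snoc eu p (E-sym G ev) , un , al
  within : ∀ i j {v} → v ∈ₗ proj₁ (route i j) → layer (pair i j) v ≡ true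
  within i j = All.lookup (proj₂ (proj₂ (proj₂ (route i j))))

hadwiger-width : ∀ {G t} → IsCircleGraph G → IsHadwiger G t → TreeDecomp G (32 * suc t + 8)
hadwiger-width {t = t} circle (_ , most) with decomposition-or-nest circle (suc t)
... | inj₁ D = D
... | inj₂ S = ⊥-elim (ℕ.<⇒≱ ℕ.≤-refl (most _ (nest⇒minor S)))

hajos-width : ∀ {G t} → IsCircleGraph G → IsHajos G t → TreeDecomp G (32 * (suc t + suc t * suc t) + 8)
hajos-width {t = t} circle (_ , most) with decomposition-or-nest circle (suc t + suc t * suc t)
... | inj₁ D = D
... | inj₂ S = ⊥-elim (ℕ.<⇒≱ ℕ.≤-refl (most _ (nest⇒top-minor (suc t) S)))

-- Extremal examples

one-bag : ∀ G {k} → n G ≤ suc k → TreeDecomp G k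
one-bag G {k} n≤ = record
  { T = rootedGraph single
  ; tree = rooted-tree single
  ; bag = λ _ → full
  ; cover-v = λ _ → zero , S.∈⊤
  ; cover-e = λ _ _ _ → zero , S.∈⊤ , S.∈⊤
  ; coherent = λ { _ zero zero p _ → here p }
  ; width = λ _ → subst (_≤ suc k) (sym (S.∣⊤∣≡n (n G))) n≤
  }

-- A least width exists up to double negation, by descent from `n G`. This suffices for the lower
-- bounds, which are decidable inequalities.
¬¬-treewidth : ∀ G → ¬ ¬ ∃ (IsTreewidth G)
¬¬-treewidth G none = no-decomposition (suc (n G)) (n G) ℕ.≤-refl (one-bag G (ℕ.n≤1+n (n G)))
  where
  no-decomposition : ∀ f k → k < f → TreeDecomp G k → ⊥
  no-decomposition (suc f) k (s≤s k≤f) D = none (k , D , least)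
    where
    least : ∀ j → TreeDecomp G j → k ≤ j
    least j D' with k ≤? j
    ... | yes p = p
    ... | no ¬p = ⊥-elim (no-decomposition f j (ℕ.<-≤-trans (ℕ.≰⇒> ¬p) k≤f) D')

¬¬-hadwiger : ∀ {G t} → KMinor G t → ¬ ¬ ∃ (IsHadwiger G)
¬¬-hadwiger {G} {t} K none = no-minor (suc (suc (n G))) t (ℕ.m≤m+n _ t) K
  where
  bound : ∀ {s} → KMinor G s → s ≤ suc (n G)
  bound K = minor≤width K (one-bag G (ℕ.n≤1+n (n G)))
  no-minor : ∀ f s → suc (suc (n G)) ≤ f + s → KMinor G s → ⊥
  no-minor zero s big K = ℕ.<⇒≱ big (bound K)
  no-minor (suc f) s big K = none (s , K , most)
    where
    most : ∀ s' → KMinor G s' → s' ≤ s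
    most s' K' with s' ≤? s
    ... | yes p = p
    ... | no ¬p = ⊥-elim (no-minor f s' (ℕ.≤-trans big (ℕ.≤-trans (ℕ.≤-reflexive (sym (ℕ.+-suc f s)))
                    (ℕ.+-monoʳ-≤ f (ℕ.≰⇒> ¬p)))) K')

enumerate : ∀ {s} (f : Fin s → Bool) {k} → k ≤ count f →
            ∃ λ (e : Fin k → Fin s) → (∀ i → f (e i) ≡ true) × (∀ {i j} → i F.< j → e i F.< e j)
enumerate f {zero} _ = (λ ()) , (λ ()) , λ { {()} }
enumerate {suc s} f {suc k} q with f zero in eq
... | false with enumerate (f ∘ suc) q
...   | e , fe , mono = suc ∘ e , fe , λ i<j → s≤s (mono i<j)
enumerate {suc s} f {suc k} q | true with enumerate (f ∘ suc) (ℕ.≤-pred q)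
...   | e , fe , mono = e' , fe' , mono'
  where
  e' : Fin (suc k) → Fin (suc s)
  e' zero = zero
  e' (suc i) = suc (e i)
  fe' : ∀ i → f (e' i) ≡ true
  fe' zero = eq
  fe' (suc i) = fe i
  mono' : ∀ {i j} → i F.< j → e' i F.< e' j
  mono' {zero} {suc j} _ = s≤s z≤n
  mono' {suc i} {suc j} (s≤s i<j) = s≤s (mono i<j)

-- Branch vertices in an independent set whose neighbourhood has t vertices: the first inner vertices
-- of the paths joining them are distinct.
independent-branches : ∀ {G s} (K : TopKMinor G s) (side : Fin (n G) → Bool) {t} (nbr : Fin t → Fin (n G)) →
  (∀ {u w} → side u ≡ true → E G u w → side w ≡ false × ∃ λ r → w ≡ nbr r) →
  ∀ {q} → q + q ≤ count (side ∘ TopKMinor.bv K) → q * q ≤ t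
independent-branches {G} {s} K side {t} nbr opposite {q} many with enumerate (side ∘ TopKMinor.bv K) many
... | e , e-side , e-mono = F.injective⇒≤ {f = g} g-inj
  where
  open TopKMinor K
  -- Every index of the first half is below every index of the second, so all q² mixed pairs are
  -- joined by a path of `K`.
  lo hi : Fin q → Fin s
  lo i = e (i ↑ˡ q)
  hi j = e (q ↑ʳ j)
  lo<hi : ∀ i j → lo i F.< hi j
  lo<hi i j = e-mono (ℕ.≤-trans (s≤s (ℕ.≤-reflexive (F.toℕ-↑ˡ i q)))
    (ℕ.≤-trans (F.toℕ<n i) (ℕ.≤-trans (ℕ.m≤m+n q (toℕ j)) (ℕ.≤-reflexive (sym (F.toℕ-↑ʳ q j))))))
  e-inj : ∀ {i j} → e i ≡ e j → i ≡ j
  e-inj {i} {j} eq with F.<-cmp i j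
  ... | tri< l _ _ = ⊥-elim (ℕ.<⇒≢ (e-mono l) (cong toℕ eq))
  ... | tri≈ _ p _ = p
  ... | tri> _ _ l = ⊥-elim (ℕ.<⇒≢ (e-mono l) (cong toℕ (sym eq)))
  first : ∀ {u v} l → Linked (E G) (u ∷ l ++ v ∷ []) → side u ≡ true → side v ≡ true → ∃ λ r → nbr r ∈ₗ l
  first [] (edge ∷ _) su sv = ⊥-elim (true≢false (trans (sym sv) (proj₁ (opposite su edge))))
  first (w ∷ l) (edge ∷ _) su sv with opposite su edge
  ... | _ , r , refl = r , here refl
  start : ∀ i j → ∃ λ r → nbr r ∈ₗ inner (lo i) (hi j)
  start i j = first (inner (lo i) (hi j)) (path (lo i) (hi j) (lo<hi i j)) (e-side _) (e-side _)
  start-inj : ∀ i j i' j' → proj₁ (start i j) ≡ proj₁ (start i' j') → i ≡ i' × j ≡ j'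
  start-inj i j i' j' eq with i F.≟ i' | j F.≟ j'
  ... | yes p | yes p' = p , p'
  ... | no ne | _ = ⊥-elim (disjoint (lo i) (hi j) (lo i') (hi j') (lo<hi i j) (lo<hi i' j')
          (inj₁ (ne ∘ F.↑ˡ-injective q i i' ∘ e-inj)) _ (proj₂ (start i j))
          (subst (λ r → nbr r ∈ₗ inner (lo i') (hi j')) (sym eq) (proj₂ (start i' j'))))
  ... | _ | no ne = ⊥-elim (disjoint (lo i) (hi j) (lo i') (hi j') (lo<hi i j) (lo<hi i' j')
          (inj₂ (ne ∘ F.↑ʳ-injective q j j' ∘ e-inj)) _ (proj₂ (start i j))
          (subst (λ r → nbr r ∈ₗ inner (lo i') (hi j')) (sym eq) (proj₂ (start i' j'))))
  g : Fin (q * q) → Fin t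
  g x = let i , j = F.remQuot q x in proj₁ (start i j)
  g-inj : ∀ {x y} → g x ≡ g y → x ≡ y
  g-inj {x} {y} eq with start-inj _ _ _ _ eq
  ... | p , p' = trans (sym (F.combine-remQuot {q} q x)) (trans (cong₂ F.combine p p') (F.combine-remQuot {q} q y))

-- The chord diagram of the disjoint union of K_{t,t} and K_x: the chords of each side of K_{t,t}
-- share an endpoint.
module Example (t x : ℕ) where

  data Vertex : Set where
    L R : Fin t → Vertex
    Q : Fin x → Vertex

  size : ℕ
  size = (t + t) + x

  decode : Fin size → Vertex
  decode u = [ (λ w → [ L , R ]′ (splitAt t w)) , Q ]′ (splitAt (t + t) u)

  encode : Vertex → Fin size
  encode (L i) = (i ↑ˡ t) ↑ˡ x
  encode (R i) = (t ↑ʳ i) ↑ˡ x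
  encode (Q l) = (t + t) ↑ʳ l

  decode-encode : ∀ v → decode (encode v) ≡ v
  decode-encode (L i) rewrite F.splitAt-↑ˡ (t + t) (i ↑ˡ t) x | F.splitAt-↑ˡ t i t = refl
  decode-encode (R i) rewrite F.splitAt-↑ˡ (t + t) (t ↑ʳ i) x | F.splitAt-↑ʳ t t i = refl
  decode-encode (Q l) rewrite F.splitAt-↑ʳ (t + t) x l = refl

  encode-decode : ∀ u → encode (decode u) ≡ u
  encode-decode u with splitAt (t + t) u in eq
  ... | inj₂ l = F.splitAt⁻¹-↑ʳ eq
  ... | inj₁ w with splitAt t w in eq'
  ...   | inj₁ i = trans (cong (_↑ˡ x) (F.splitAt⁻¹-↑ˡ eq')) (F.splitAt⁻¹-↑ˡ eq)
  ...   | inj₂ i = trans (cong (_↑ˡ x) (F.splitAt⁻¹-↑ʳ eq')) (F.splitAt⁻¹-↑ˡ eq)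

  base : ℕ
  base = suc (suc (t + t))

  -- For K_{t,t} the positions are 0, the starts 1 to t of the `R` chords, the ends t + 1 to 2t of
  -- the `L` chords, and 2t + 1. The `Q` chords lie beyond, all starting before the first of them
  -- ends.
  lo hi : Vertex → ℕ
  lo (L i) = 0
  lo (R j) = suc (toℕ j)
  lo (Q l) = base + toℕ l
  hi (L i) = suc t + toℕ i
  hi (R j) = suc (t + t)
  hi (Q l) = base + (x + toℕ l)

  private
    R<base : ∀ (j : Fin t) k → suc (toℕ j) < base + k
    R<base j k = s≤s (s≤s (ℕ.≤-trans (ℕ.<⇒≤ (F.toℕ<n j)) (ℕ.≤-trans (ℕ.m≤m+n t t) (ℕ.m≤m+n (t + t) k))))

    L<base : ∀ (i : Fin t) k → suc t + toℕ i < base + k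
    L<base i k = s≤s (s≤s (ℕ.≤-trans (ℕ.+-monoʳ-≤ t (ℕ.<⇒≤ (F.toℕ<n i))) (ℕ.m≤m+n (t + t) k)))

  lo<hi : ∀ v → lo v < hi v
  lo<hi (L i) = s≤s z≤n
  lo<hi (R j) = s≤s (ℕ.≤-trans (F.toℕ<n j) (ℕ.m≤m+n t t))
  lo<hi (Q l) = ℕ.+-monoʳ-< base (ℕ.+-monoˡ-< (toℕ l) (ℕ.≤-<-trans z≤n (F.toℕ<n l)))

  ends-distinct : ∀ v w → lo v ≡ lo w → hi v ≡ hi w → v ≡ w
  ends-distinct (L i) (L j) _ e = cong L (F.toℕ-injective (ℕ.+-cancelˡ-≡ (suc t) _ _ e))
  ends-distinct (R i) (R j) e _ = cong R (F.toℕ-injective (ℕ.suc-injective e))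
  ends-distinct (R j) (Q l) e _ = ⊥-elim (ℕ.<⇒≢ (R<base j (toℕ l)) e)
  ends-distinct (Q l) (R j) e _ = ⊥-elim (ℕ.<⇒≢ (R<base j (toℕ l)) (sym e))
  ends-distinct (Q l) (Q l') e _ = cong Q (F.toℕ-injective (ℕ.+-cancelˡ-≡ base _ _ e))

  chords : ChordFamily size
  chords = record
    { a = lo ∘ decode
    ; b = hi ∘ decode
    ; a<b = lo<hi ∘ decode
    ; distinct = λ u v e f → trans (sym (encode-decode u))
                   (trans (cong encode (ends-distinct (decode u) (decode v) e f)) (encode-decode v))
    }

  graph : Graph
  graph = crossGraph chords

  circle : IsCircleGraph graph
  circle = size , chords , record
    { to = λ u → u ; from = λ u → u ; from-to = λ _ → refl ; to-from = λ _ → refl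
    ; pres = λ _ _ e → e ; reflect = λ _ _ e → e }

  X : Vertex → Vertex → Set
  X v w = Crosses (lo v) (hi v) (lo w) (hi w)

  X⇒E : ∀ v w → X v w → E graph (encode v) (encode w)
  X⇒E v w c rewrite decode-encode v | decode-encode w = c

  LR : ∀ i j → X (L i) (R j)
  LR i j = inj₁ (s≤s z≤n , s≤s (ℕ.≤-trans (F.toℕ<n j) (ℕ.m≤m+n t (toℕ i))) , s≤s (ℕ.+-monoʳ-< t (F.toℕ<n i)))

  QQ : ∀ {l l'} → l F.< l' → X (Q l) (Q l')
  QQ {l} {l'} lt = inj₁ (ℕ.+-monoʳ-< base lt
    , ℕ.+-monoʳ-< base (ℕ.<-≤-trans (F.toℕ<n l') (ℕ.m≤m+n x (toℕ l)))
    , ℕ.+-monoʳ-< base (ℕ.+-monoʳ-< x lt))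

  data Adjacent : Vertex → Vertex → Set where
    lr : ∀ {i j} → Adjacent (L i) (R j)
    rl : ∀ {i j} → Adjacent (R i) (L j)
    qq : ∀ {l l'} → Adjacent (Q l) (Q l')

  X⇒adjacent : ∀ v w → X v w → Adjacent v w
  X⇒adjacent (L i) (R j) _ = lr
  X⇒adjacent (R i) (L j) _ = rl
  X⇒adjacent (Q l) (Q l') _ = qq
  X⇒adjacent (L i) (L j) (inj₁ (() , _))
  X⇒adjacent (L i) (L j) (inj₂ (() , _))
  X⇒adjacent (L i) (Q l) (inj₁ (_ , c , _)) = ⊥-elim (ℕ.<-asym c (L<base i (toℕ l)))
  X⇒adjacent (R i) (R j) (inj₁ (_ , _ , c)) = ⊥-elim (ℕ.<-irrefl refl c)
  X⇒adjacent (R i) (R j) (inj₂ (_ , _ , c)) = ⊥-elim (ℕ.<-irrefl refl c)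
  X⇒adjacent (R i) (Q l) (inj₁ (_ , c , _)) = ⊥-elim (ℕ.<-asym c (s≤s (s≤s (ℕ.m≤m+n (t + t) (toℕ l)))))
  X⇒adjacent (R i) (Q l) (inj₂ (c , _)) = ⊥-elim (ℕ.<-asym c (R<base i (toℕ l)))
  X⇒adjacent (Q l) (L i) (inj₂ (_ , c , _)) = ⊥-elim (ℕ.<-asym c (L<base i (toℕ l)))
  X⇒adjacent (Q l) (R i) (inj₁ (c , _)) = ⊥-elim (ℕ.<-asym c (R<base i (toℕ l)))
  X⇒adjacent (Q l) (R i) (inj₂ (_ , c , _)) = ⊥-elim (ℕ.<-asym c (s≤s (s≤s (ℕ.m≤m+n (t + t) (toℕ l)))))

  encode-inj : ∀ v w → encode v ≡ encode w → v ≡ w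
  encode-inj v w e = trans (sym (decode-encode v)) (trans (cong decode e) (decode-encode w))

  clique : TopKMinor graph x
  clique = record
    { bv = encode ∘ Q
    ; bv-inj = λ i j e → Q-inj (encode-inj (Q i) (Q j) e)
    ; inner = λ _ _ → []
    ; path = λ i j lt → X⇒E (Q i) (Q j) (QQ lt) ∷ [-]
    ; uniq = λ _ _ _ → []
    ; avoid = λ _ _ _ _ _ ()
    ; disjoint = λ _ _ _ _ _ _ _ _ ()
    }
    where
    Q-inj : ∀ {i j} → Q i ≡ Q j → i ≡ j
    Q-inj refl = refl

  biclique-minor : KMinor graph t
  biclique-minor = record
    { branch = λ i → tabulate (does ∘ edge? i)
    ; nonempty = λ i → _ , into i (inj₁ refl)
    ; connected = λ i u v p q → walk i (out i p) (out i q)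
    ; disjoint = λ i j i≢j v p q → i≢j (apart (out i p) (out j q))
    ; adjacent = λ i j _ → _ , _ , into i (inj₁ refl) , into j (inj₂ refl) , X⇒E (L i) (R j) (LR i j)
    }
    where
    Edge : Fin t → Fin size → Set
    Edge i u = u ≡ encode (L i) ⊎ u ≡ encode (R i)
    edge? : ∀ i u → Dec (Edge i u)
    edge? i u = (u F.≟ encode (L i)) ⊎-dec (u F.≟ encode (R i))
    into : ∀ i {u} → Edge i u → u ∈ tabulate (does ∘ edge? i)
    into i e = ∈-tabulate⁺ (does ∘ edge? i) (dec-true (edge? i _) e)
    out : ∀ i {u} → u ∈ tabulate (does ∘ edge? i) → Edge i u
    out i p = does-true⁻ (edge? i _) (∈-tabulate⁻ (does ∘ edge? i) p)
    walk : ∀ i {u v} → Edge i u → Edge i v → WalkIn graph (_∈ tabulate (does ∘ edge? i)) u v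
    walk i (inj₁ refl) (inj₁ refl) = here (into i (inj₁ refl))
    walk i (inj₂ refl) (inj₂ refl) = here (into i (inj₂ refl))
    walk i (inj₁ refl) (inj₂ refl) = step (into i (inj₁ refl)) (X⇒E (L i) (R i) (LR i i)) (here (into i (inj₂ refl)))
    walk i (inj₂ refl) (inj₁ refl) =
      step (into i (inj₂ refl)) (E-sym graph {encode (L i)} {encode (R i)} (X⇒E (L i) (R i) (LR i i)))
        (here (into i (inj₁ refl)))
    L-inj : ∀ {i j} → L i ≡ L j → i ≡ j
    L-inj refl = refl
    R-inj : ∀ {i j} → R i ≡ R j → i ≡ j
    R-inj refl = refl
    apart : ∀ {i j u} → Edge i u → Edge j u → i ≡ j
    apart {i} {j} (inj₁ e) (inj₁ f) = L-inj (encode-inj (L i) (L j) (trans (sym e) f))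
    apart {i} {j} (inj₂ e) (inj₂ f) = R-inj (encode-inj (R i) (R j) (trans (sym e) f))
    apart {i} {j} (inj₁ e) (inj₂ f) with () ← encode-inj (L i) (R j) (trans (sym e) f)
    apart {i} {j} (inj₂ e) (inj₁ f) with () ← encode-inj (R i) (L j) (trans (sym e) f)

  isL isR isQ : Vertex → Bool
  isL (L _) = true
  isL _ = false
  isR (R _) = true
  isR _ = false
  isQ (Q _) = true
  isQ _ = false

  private
    L-opposite : ∀ {u w} → isL (decode u) ≡ true → E graph u w → isL (decode w) ≡ false × ∃ λ r → w ≡ encode (R r)
    L-opposite {u} {w} p e with decode u | decode w in eq
    ... | v | v' with X⇒adjacent v v' e
    ...   | lr {j = j} = refl , j , trans (sym (encode-decode w)) (cong encode eq)
    ...   | rl with () ← p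
    ...   | qq with () ← p

    R-opposite : ∀ {u w} → isR (decode u) ≡ true → E graph u w → isR (decode w) ≡ false × ∃ λ r → w ≡ encode (L r)
    R-opposite {u} {w} p e with decode u | decode w in eq
    ... | v | v' with X⇒adjacent v v' e
    ...   | rl {j = j} = refl , j , trans (sym (encode-decode w)) (cong encode eq)
    ...   | lr with () ← p
    ...   | qq with () ← p

    edge-isQ : ∀ {u w} → E graph u w → isQ (decode u) ≡ isQ (decode w)
    edge-isQ {u} {w} e with X⇒adjacent (decode u) (decode w) e
    ... | c with decode u | decode w
    edge-isQ e | lr | _ | _ = refl
    edge-isQ e | rl | _ | _ = refl
    edge-isQ e | qq | _ | _ = refl

    linked-isQ : ∀ {u w} l → Linked (E graph) (u ∷ l ++ w ∷ []) → isQ (decode u) ≡ isQ (decode w)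
    linked-isQ {u} {w} [] (e ∷ _) = edge-isQ {u} {w} e
    linked-isQ {u} (v ∷ l) (e ∷ es) = trans (edge-isQ {u} {v} e) (linked-isQ l es)

  -- Paths do not leave a component, so the branch vertices lie all in K_x or all in K_{t,t}. In the
  -- second case more than `x` of them would put at least 2q on one side, and `independent-branches`
  -- would give q² ≤ t.
  top-minor-bound : ∀ {q s} → t < q * q → 4 * q ≤ suc x → TopKMinor graph s → s ≤ x
  top-minor-bound {q} {s} t<qq 4q≤ K with s ≤? x
  ... | yes p = p
  ... | no ¬p with F.all? (λ i → isQ (decode (bv i)) Bool.≟ true)
    where open TopKMinor K
  ...   | yes allQ = F.injective⇒≤ {f = λ i → proj₁ (index i)} inj
    where
    open TopKMinor K
    isQ⁻ : ∀ {v} → isQ v ≡ true → ∃ λ l → v ≡ Q l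
    isQ⁻ {Q l} _ = l , refl
    index : ∀ i → ∃ λ l → decode (bv i) ≡ Q l
    index i = isQ⁻ (allQ i)
    inj : ∀ {i j} → proj₁ (index i) ≡ proj₁ (index j) → i ≡ j
    inj {i} {j} e = bv-inj i j (trans (sym (encode-decode (bv i))) (trans (cong encode
      (trans (proj₂ (index i)) (trans (cong Q e) (sym (proj₂ (index j)))))) (encode-decode (bv j))))
  ...   | no ¬allQ = ⊥-elim (ℕ.<⇒≱ t<qq few)
    where
    open TopKMinor K
    same : ∀ i j → isQ (decode (bv i)) ≡ isQ (decode (bv j))
    same i j with F.<-cmp i j
    ... | tri< l _ _ = linked-isQ (inner i j) (path i j l)
    ... | tri≈ _ refl _ = refl
    ... | tri> _ _ l = sym (linked-isQ (inner j i) (path j i l))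
    noneQ : ∀ i → isQ (decode (bv i)) ≡ false
    noneQ i with isQ (decode (bv i)) in eq
    ... | false = refl
    ... | true = ⊥-elim (¬allQ (λ j → trans (same j i) eq))
    lefts rights : ℕ
    lefts = count (isL ∘ decode ∘ bv)
    rights = count (isR ∘ decode ∘ bv)
    count-all : ∀ {m} → count {m} (λ _ → true) ≡ m
    count-all {zero} = refl
    count-all {suc m} = cong suc count-all
    total : s ≤ lefts + rights
    total = ℕ.≤-trans (ℕ.≤-reflexive (sym (count-all {s})))
      (count-subadditive (λ _ → true) (isL ∘ decode ∘ bv) (isR ∘ decode ∘ bv)
        (λ i → one-side (decode (bv i)) (noneQ i)))
      where
      one-side : ∀ v → isQ v ≡ false → 1 ≤ bit (isL v) + bit (isR v)
      one-side (L _) _ = ℕ.≤-refl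
      one-side (R _) _ = ℕ.≤-refl
    enough : (q + q) + (q + q) ≤ lefts + rights
    enough = ℕ.≤-trans (ℕ.≤-trans (ℕ.≤-reflexive (four q)) (ℕ.≤-trans 4q≤ (ℕ.≰⇒> ¬p))) total
      where
      open +-*-Solver
      four : ∀ q → (q + q) + (q + q) ≡ 4 * q
      four = solve 1 (λ q → (q :+ q) :+ (q :+ q) := con 4 :* q) refl
    larger : ∀ {k u v} → k + k ≤ u + v → k ≤ u ⊎ k ≤ v
    larger {k} {u} {v} e with k ≤? u
    ... | yes p = inj₁ p
    ... | no ¬p = inj₂ (ℕ.+-cancelˡ-≤ k k v (ℕ.≤-trans e (ℕ.+-monoˡ-≤ v (ℕ.<⇒≤ (ℕ.≰⇒> ¬p)))))
    few : q * q ≤ t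
    few with larger {q + q} {lefts} {rights} enough
    ... | inj₁ p = independent-branches K (isL ∘ decode) (encode ∘ R) (λ {u} {w} → L-opposite {u} {w}) {q} p
    ... | inj₂ p = independent-branches K (isR ∘ decode) (encode ∘ L) (λ {u} {w} → R-opposite {u} {w}) {q} p

  hajos : ∀ {q} → t < q * q → 4 * q ≤ suc x → IsHajos graph x
  hajos {q} t<qq 4q≤ = clique , λ s → top-minor-bound {q} t<qq 4q≤

quarter : ∀ x → ∃ λ q → 4 * q ≤ suc x × suc x ≤ 4 * q + 3
quarter x = q , subst (4 * q ≤_) (sym split) (ℕ.≤-trans (ℕ.≤-reflexive (ℕ.*-comm 4 q)) (ℕ.m≤n+m (q * 4) (suc x % 4)))
          , ℕ.≤-trans (ℕ.≤-reflexive split) (ℕ.≤-trans (ℕ.+-mono-≤ (ℕ.≤-pred (m%n<n (suc x) 4)) ℕ.≤-refl)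
              (ℕ.≤-reflexive (trans (ℕ.+-comm 3 (q * 4)) (cong (_+ 3) (ℕ.*-comm q 4)))))
  where
  q = suc x / 4
  split : suc x ≡ suc x % 4 + q * 4
  split = m≡m%n+[m/n]*n (suc x) 4

-- The constant 50 is 25 doubled: `x` is at most 5q because q ≥ 2, and the summand 2 is absorbed by
-- `y`, which is at least 2 for the same reason.
quadratic-bound : ∀ {x q y} → 2 ≤ q → suc x ≤ 4 * q + 3 → q * q ≤ 2 + y → x * x ≤ 50 * y
quadratic-bound {x} {q} {y} 2≤q x< qq≤ = begin
    x * x                 ≤⟨ ℕ.*-mono-≤ x≤5q x≤5q ⟩
    5 * q * (5 * q)       ≡⟨ solve 1 (λ q → con 5 :* q :* (con 5 :* q) := con 25 :* (q :* q)) refl q ⟩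
    25 * (q * q)          ≤⟨ ℕ.*-monoʳ-≤ 25 qq≤ ⟩
    25 * (2 + y)          ≤⟨ ℕ.*-monoʳ-≤ 25 (ℕ.+-monoˡ-≤ y 2≤y) ⟩
    25 * (y + y)          ≡⟨ solve 1 (λ y → con 25 :* (y :+ y) := con 50 :* y) refl y ⟩
    50 * y                ∎
  where
  open ℕ.≤-Reasoning
  open +-*-Solver
  2≤y : 2 ≤ y
  2≤y = ℕ.+-cancelˡ-≤ 2 2 y (ℕ.≤-trans (ℕ.*-mono-≤ 2≤q 2≤q) qq≤)
  x≤5q : x ≤ 5 * q
  x≤5q = ℕ.≤-pred (begin
    suc x           ≤⟨ x< ⟩
    4 * q + 3       ≡⟨ solve 1 (λ q → con 4 :* q :+ con 3 := con 1 :+ (con 2 :+ con 4 :* q)) refl q ⟩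
    suc (2 + 4 * q) ≤⟨ s≤s (ℕ.+-monoˡ-≤ (4 * q) 2≤q) ⟩
    suc (5 * q)     ∎)

-- Here t = q² − 1 with q = ⌊(x+1)/4⌋, the largest t for which independent-branches excludes a
-- topological K_{x+1}.
quadratic-witness : ∀ {x} → 7 ≤ x → ∃ λ t → IsHajos (Example.graph t x) x ×
                    (∀ {y} → t ≤ suc y → x * x ≤ 50 * y)
quadratic-witness {x} 7≤x with quarter x
... | zero , _ , hi = ⊥-elim (ℕ.<⇒≱ (ℕ.≤-trans 7≤x (ℕ.<⇒≤ hi)) (s≤s (s≤s (s≤s z≤n))))
... | 1 , _ , hi = ⊥-elim (ℕ.<⇒≱ (ℕ.≤-trans (s≤s 7≤x) hi) ℕ.≤-refl)
... | q@(suc (suc _)) , lo , hi = _ , Example.hajos _ x {q} ℕ.≤-refl lo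
  , λ {y} t≤ → quadratic-bound {x} {q} {y} (s≤s (s≤s z≤n)) hi (s≤s t≤)

module _ (x : ℕ) where
  -- With t = 0 the biclique is empty and the graph is complete on `x + 1` vertices.
  open Example 0 (suc x)

  complete-treewidth : IsTreewidth graph x
  complete-treewidth = one-bag graph ℕ.≤-refl , λ j D → ℕ.≤-pred (minor≤width (top-minor⇒minor clique) D)

  complete-hadwiger : IsHadwiger graph (suc x)
  complete-hadwiger = top-minor⇒minor clique , λ s K → minor≤width K (one-bag graph ℕ.≤-refl)

  complete-circle : IsCircleGraph graph
  complete-circle = circle

-- The ties and their optimality

tw-had-linear : LinearlyTied tw had
tw-had-linear = 32 , 40 , λ { G circle x y (D , least) (Level.lift H) →
    ℕ.≤-trans (least _ (hadwiger-width circle H)) (ℕ.≤-reflexive (expand y))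
  , ℕ.≤-trans (minor≤width (proj₁ H) D) (weaken x) }
  where
  open +-*-Solver
  expand : ∀ y → 32 * suc y + 8 ≡ 32 * y + 40
  expand = solve 1 (λ y → con 32 :* (con 1 :+ y) :+ con 8 := con 32 :* y :+ con 40) refl
  weaken : ∀ x → suc x ≤ 32 * x + 40
  weaken x = ℕ.≤-trans (ℕ.≤-reflexive (ℕ.+-comm 1 x)) (ℕ.+-mono-≤ (ℕ.m≤n*m x 32) (s≤s z≤n))

private
  -- One polynomial for both ties: the width bound of `hajos-width`, plus 1 because the Hadwiger
  -- number is at most the treewidth plus one.
  quad : ℕ → ℕ
  quad x = 32 * (x * x) + 96 * x + 73

  expand-quad : ∀ h → suc (32 * (suc h + suc h * suc h) + 8) ≡ quad h
  expand-quad = solve 1 (λ h → con 1 :+ (con 32 :* ((con 1 :+ h) :+ (con 1 :+ h) :* (con 1 :+ h)) :+ con 8)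
                           := con 32 :* (h :* h) :+ con 96 :* h :+ con 73) refl
    where open +-*-Solver

  suc≤quad : ∀ y → suc y ≤ quad y
  suc≤quad y = ℕ.≤-trans (ℕ.≤-reflexive (ℕ.+-comm 1 y))
    (ℕ.+-mono-≤ (ℕ.≤-trans (ℕ.m≤n*m y 96) (ℕ.m≤n+m (96 * y) (32 * (y * y)))) (s≤s z≤n))

haj-tw-quadratic : QuadraticallyTied haj tw
haj-tw-quadratic = 32 , 96 , 73 , λ { G circle x y (Level.lift J) (D , least) →
    ℕ.≤-trans (minor≤width (top-minor⇒minor (proj₁ J)) D) (suc≤quad y)
  , ℕ.≤-trans (ℕ.m≤n⇒m≤1+n (least _ (hajos-width circle J))) (ℕ.≤-reflexive (expand-quad x)) }

haj-had-quadratic : QuadraticallyTied haj had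
haj-had-quadratic = 32 , 96 , 73 , λ { G circle x y (Level.lift J) (Level.lift H) →
    ℕ.≤-trans (proj₂ H _ (top-minor⇒minor (proj₁ J))) (ℕ.≤-trans (ℕ.n≤1+n y) (suc≤quad y))
  , ℕ.≤-trans (minor≤width (proj₁ H) (hajos-width circle J)) (ℕ.≤-reflexive (expand-quad x)) }

-- The complete graph of order n has treewidth n - 1 and Hadwiger number n, so n - 1 ≤ f(n), and n ≤
-- 2(n - 1) from n = 2 on.
tw-had-optimal : ∀ f → TiedBy tw had f → IsΩLinear f
tw-had-optimal f tied = 2 , 2 , λ { 1 (s≤s ()) ; (suc (suc x)) _ →
    let x≤f = proj₁ (tied _ (complete-circle (suc x)) _ _
                (complete-treewidth (suc x)) (Level.lift (complete-hadwiger (suc x))))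
    in ℕ.≤-trans (double x) (ℕ.*-monoʳ-≤ 2 x≤f) }
  where
  double : ∀ x → suc (suc x) ≤ 2 * suc x
  double x = s≤s (ℕ.≤-trans (s≤s (ℕ.m≤m+n x 0)) (ℕ.m≤n+m (suc (x + 0)) x))

-- The Hajós number of the example is exactly `x`. Its treewidth `y` is available only under a
-- double negation, removed by deciding the final inequality; the K_t minor gives t ≤ y + 1, and y ≤
-- f(x).
haj-tw-optimal : ∀ f → TiedBy haj tw f → IsΩQuadratic f
haj-tw-optimal f tied = 50 , 7 , λ x 7≤x → let t , J , bound = quadratic-witness 7≤x in
  decidable-stable (x * x ≤? 50 * f x) λ fails → ¬¬-treewidth (Example.graph t x) λ { (y , D , least) →
    fails (bound (ℕ.≤-trans (minor≤width (Example.biclique-minor t x) D)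
      (s≤s (proj₂ (tied _ (Example.circle t x) x y (Level.lift J) (D , least)))))) }

haj-had-optimal : ∀ f → TiedBy haj had f → IsΩQuadratic f
haj-had-optimal f tied = 50 , 7 , λ x 7≤x → let t , J , bound = quadratic-witness 7≤x in
  decidable-stable (x * x ≤? 50 * f x) λ fails → ¬¬-hadwiger (Example.biclique-minor t x) λ { (y , H) →
    fails (bound (ℕ.≤-trans (proj₂ H _ (Example.biclique-minor t x))
      (ℕ.m≤n⇒m≤1+n (proj₂ (tied _ (Example.circle t x) x y (Level.lift J) (Level.lift H)))))) }

theorem2 : LinearlyTied tw had
    × QuadraticallyTied haj tw
    × QuadraticallyTied haj had
    × (∀ (f : ℕ → ℕ) → TiedBy tw had f → IsΩLinear f)
    × (∀ (f : ℕ → ℕ) → TiedBy haj tw f → IsΩQuadratic f)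
    × (∀ (f : ℕ → ℕ) → TiedBy haj had f → IsΩQuadratic f)
theorem2 = tw-had-linear , haj-tw-quadratic , haj-had-quadratic , tw-had-optimal , haj-tw-optimal , haj-had-optimal
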